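{- Let $G$ be a graph of order $n\ge 6$. Then $$\sigma_1(G)+\sigma_1(\overline{G})\ \le\ \frac{27}{64}\cdot 2^n+\frac{1}{2}(n+2)(n-3),$$ with equality if and only if $G$ is isomorphic to $3K_2\cup\overline{K_{n-6}}$ or to $K_{n-6}\vee G_{6,4}$, where $G_{6,4}$ is the connected $4$-regular graph of order $6$, i.e. $G_{6,4}\cong\overline{3K_2}$.
   Context: All graphs are finite, simple and undirected; the order of a graph is its number of vertices. $\overline{G}$ denotes the complement of $G$ (same vertex set, two distinct vertices being adjacent in $\overline{G}$ iff they are not adjacent in $G$). $K_m$ is the complete graph on $m$ vertices and $\overline{K_m}$ the edgeless graph on $m$ vertices. $G_1\cup G_2$ denotes the disjoint union of graphs, $3K_2$ is the disjoint union of three copies of $K_2$, and $3K_2\cup\overline{K_{n-6}}$ is the graph consisting of three disjoint copies of $K_2$ together with $n-6$ isolated vertices. The join $G_1\vee G_2$ of disjoint graphs is obtained from $G_1\cup G_2$ by adding all edges $uv$ with $u\in V(G_1)$, $v\in V(G_2)$. When $n=6$ the parts $\overline{K_{n-6}}$ and $K_{n-6}$ have no vertices, so the two graphs are $3K_2$ and $\overline{3K_2}$. A subset $S\subseteq V(G)$ is called a $1$-nearly independent vertex subset of $G$ if the subgraph of $G$ induced by $S$ contains exactly one edge; $\sigma_1(G)$ denotes the number of $1$-nearly independent vertex subsets of $G$. -}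

module Defs where

open import Data.Bool.Base using (Bool; true; false; not; _∧_)
import Data.Bool.Properties as Bool
open import Data.Empty using (⊥)
open import Data.Fin.Base using (Fin; _<_; splitAt)
open import Data.Fin.Permutation using (Permutation; _⟨$⟩ʳ_)
open import Data.Fin.Properties using (_≟_; _<?_; all?; any?)
open import Data.Fin.Subset using (Subset; inside; outside; _∈_)
open import Data.Fin.Subset.Properties using (_∈?_)
open import Data.Integer.Base using (+_)
open import Data.List.Base
  using (List; []; _∷_; [_]; _++_; map; filter; length; allFin; cartesianProduct)
open import Data.List.Membership.Propositional using () renaming (_∈_ to _∈ˡ_)
open import Data.List.Membership.Propositional.Properties
  using (∈-++⁺ˡ; ∈-++⁺ʳ; ∈-map⁺; ∈-map⁻)
open import Data.List.Relation.Unary.All using ([])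
open import Data.List.Relation.Unary.AllPairs using ([]; _∷_)
open import Data.List.Relation.Unary.Any using (here)
open import Data.List.Relation.Unary.Unique.Propositional using (Unique)
import Data.List.Relation.Unary.Unique.Propositional.Properties as Unique
open import Data.Nat.Base as ℕ using (ℕ; zero; suc)
import Data.Nat.Properties as ℕ
open import Data.Product.Base using (∃-syntax; _×_; _,_)
open import Data.Rational.Base using (ℚ; _/_)
open import Data.Sum.Base using (_⊎_; inj₁; inj₂)
open import Data.Vec.Base using ([]; _∷_)
open import Data.Vec.Properties using (∷-injectiveʳ)
open import Relation.Binary.Construct.Closure.ReflexiveTransitive using (Star; ε; _◅_)
open import Relation.Binary.PropositionalEquality
  using (_≡_; refl; sym; cong; cong₂)
open import Relation.Nullary.Decidable
  using (Dec; yes; no; does; _×-dec_; _⊎-dec_; toWitness; dec-true)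
open import Relation.Nullary.Negation using (contradiction)
open import Relation.Unary using (Decidable)

private
  variable
    m n : ℕ

record Graph (n : ℕ) : Set where
  field
    adj        : Fin n → Fin n → Bool
    adj-sym    : ∀ u v → adj u v ≡ adj v u
    adj-irrefl : ∀ u → adj u u ≡ false

  Adj : Fin n → Fin n → Set
  Adj u v = adj u v ≡ true

  adj? : ∀ u v → Dec (Adj u v)
  adj? u v = adj u v Bool.≟ true

open Graph public

-- The graphs may live over syntactically different orders; the bijection
-- forces m ≡ n.
infix 4 _≅_
record _≅_ (G : Graph m) (H : Graph n) : Set where
  field
    bij      : Permutation m n
    preserve : ∀ u v → adj G u v ≡ adj H (bij ⟨$⟩ʳ u) (bij ⟨$⟩ʳ v)

distinct : Fin n → Fin n → Bool
distinct u v = not (does (u ≟ v))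

distinct-sym : ∀ (u v : Fin n) → distinct u v ≡ distinct v u
distinct-sym u v with u ≟ v | v ≟ u
... | yes _   | yes _   = refl
... | no  _   | no  _   = refl
... | yes u≡v | no  v≢u = contradiction (sym u≡v) v≢u
... | no  u≢v | yes v≡u = contradiction (sym v≡u) u≢v

distinct-irrefl : ∀ (u : Fin n) → distinct u u ≡ false
distinct-irrefl u = cong not (dec-true (u ≟ u) refl)

complement : Graph n → Graph n
complement G = record
  { adj        = λ u v → distinct u v ∧ not (adj G u v)
  ; adj-sym    = λ u v → cong₂ _∧_ (distinct-sym u v) (cong not (adj-sym G u v))
  ; adj-irrefl = λ u → cong (_∧ not (adj G u u)) (distinct-irrefl u)
  }

K : ∀ n → Graph n
K n = record
  { adj        = distinct
  ; adj-sym    = distinct-sym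
  ; adj-irrefl = distinct-irrefl
  }

edgeless : ∀ n → Graph n
edgeless n = record
  { adj        = λ _ _ → false
  ; adj-sym    = λ _ _ → refl
  ; adj-irrefl = λ _ → refl
  }

-- Disjoint union and join differ only in whether vertices from different
-- parts are adjacent, which is what `cross` records.
module Combine (cross : Bool) (G : Graph m) (H : Graph n) where

  adj⊎ : Fin m ⊎ Fin n → Fin m ⊎ Fin n → Bool
  adj⊎ (inj₁ u) (inj₁ v) = adj G u v
  adj⊎ (inj₂ u) (inj₂ v) = adj H u v
  adj⊎ (inj₁ _) (inj₂ _) = cross
  adj⊎ (inj₂ _) (inj₁ _) = cross

  adj⊎-sym : ∀ u v → adj⊎ u v ≡ adj⊎ v u
  adj⊎-sym (inj₁ u) (inj₁ v) = adj-sym G u v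
  adj⊎-sym (inj₂ u) (inj₂ v) = adj-sym H u v
  adj⊎-sym (inj₁ _) (inj₂ _) = refl
  adj⊎-sym (inj₂ _) (inj₁ _) = refl

  adj⊎-irrefl : ∀ u → adj⊎ u u ≡ false
  adj⊎-irrefl (inj₁ u) = adj-irrefl G u
  adj⊎-irrefl (inj₂ u) = adj-irrefl H u

  combine : Graph (m ℕ.+ n)
  combine = record
    { adj        = λ u v → adj⊎ (splitAt m u) (splitAt m v)
    ; adj-sym    = λ u v → adj⊎-sym (splitAt m u) (splitAt m v)
    ; adj-irrefl = λ u → adj⊎-irrefl (splitAt m u)
    }

infixl 6 _∪_ _∨_
_∪_ _∨_ : Graph m → Graph n → Graph (m ℕ.+ n)
_∪_ = Combine.combine false
_∨_ = Combine.combine true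

3K₂ : Graph 6
3K₂ = K 2 ∪ K 2 ∪ K 2

G₆,₄ : Graph 6
G₆,₄ = complement 3K₂

degree : Graph n → Fin n → ℕ
degree {n} G u = length (filter (adj? G u) (allFin n))

G₆,₄-4-regular : ∀ u → degree G₆,₄ u ≡ 4
G₆,₄-4-regular = toWitness {a? = all? λ u → degree G₆,₄ u ℕ.≟ 4} _

G₆,₄-connected : ∀ u v → Star (Adj G₆,₄) u v
G₆,₄-connected u v with distance≤2 u v
  where
  distance≤2 : ∀ u v → Adj G₆,₄ u v ⊎ (∃[ w ] (Adj G₆,₄ u w × Adj G₆,₄ w v))
  distance≤2 = toWitness {a? = all? λ u → all? λ v →
    adj? G₆,₄ u v ⊎-dec any? λ w → adj? G₆,₄ u w ×-dec adj? G₆,₄ w v} _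
... | inj₁ uv            = uv ◅ ε
... | inj₂ (w , uw , wv) = uw ◅ wv ◅ ε

InducedEdge : Graph n → Subset n → Fin n × Fin n → Set
InducedEdge G S (u , v) = u < v × u ∈ S × v ∈ S × Adj G u v

inducedEdge? : (G : Graph n) (S : Subset n) → Decidable (InducedEdge G S)
inducedEdge? G S (u , v) = u <? v ×-dec u ∈? S ×-dec v ∈? S ×-dec adj? G u v

-- Each undirected edge is listed once, with its smaller endpoint first.
inducedEdges : Graph n → Subset n → List (Fin n × Fin n)
inducedEdges {n} G S = filter (inducedEdge? G S) (cartesianProduct (allFin n) (allFin n))

Is1NearlyIndependent : Graph n → Subset n → Set
Is1NearlyIndependent G S = length (inducedEdges G S) ≡ 1

is1NearlyIndependent? : (G : Graph n) → Decidable (Is1NearlyIndependent G)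
is1NearlyIndependent? G S = length (inducedEdges G S) ℕ.≟ 1

allSubsets : ∀ n → List (Subset n)
allSubsets zero    = [ [] ]
allSubsets (suc n) = map (outside ∷_) (allSubsets n) ++ map (inside ∷_) (allSubsets n)

allSubsets-complete : (S : Subset n) → S ∈ˡ allSubsets n
allSubsets-complete []            = here refl
allSubsets-complete (outside ∷ S) = ∈-++⁺ˡ (∈-map⁺ _ (allSubsets-complete S))
allSubsets-complete (inside  ∷ S) = ∈-++⁺ʳ _ (∈-map⁺ _ (allSubsets-complete S))

allSubsets-unique : ∀ n → Unique (allSubsets n)
allSubsets-unique zero    = [] ∷ []
allSubsets-unique (suc n) = Unique.++⁺
  (Unique.map⁺ ∷-injectiveʳ (allSubsets-unique n))
  (Unique.map⁺ ∷-injectiveʳ (allSubsets-unique n))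
  disjoint
  where
  disjoint : ∀ {S} → S ∈ˡ map (outside ∷_) (allSubsets n) ×
                     S ∈ˡ map (inside ∷_) (allSubsets n) → ⊥
  disjoint (S∈out , S∈in) with ∈-map⁻ _ S∈out | ∈-map⁻ _ S∈in
  ... | _ , _ , refl | _ , _ , ()

σ₁ : Graph n → ℕ
σ₁ {n} G = length (filter (is1NearlyIndependent? G) (allSubsets n))

fromℕ : ℕ → ℚ
fromℕ k = + k / 1

{-# OPTIONS --safe #-}
module Submission where

-- Fix six vertices (the window) and sort the sets S by B, the part of S outside
-- the window. The bound is the sum over all B of 39, 33, 28 or 27, according as B
-- has 0, 1, 2 or at least 3 elements, so it suffices that at most this many of the
-- sets counted belong to B. This is a finite question about the window and the
-- degrees of its vertices into B, and the answer is positive as soon as the window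
-- induces at most 27 independent sets and at most 27 cliques. If G and its
-- complement both contain a six-set with at most 27 independent sets, then
-- exchanging vertices one at a time between the two leads to such a window;
-- otherwise all edges of G or of its complement lie within six vertices or form a
-- star, and a window adapted to that works too. Equality forces 39 for B = ∅,
-- hence 3K₂ or its complement in the window; for 3K₂, equality for |B| = 1
-- excludes edges to the window and equality for |B| = 2 excludes edges outside it.

-- The window cannot be arbitrary: if B induces exactly one edge and the window is edgeless and not
-- joined to B, all 64 sets A are counted through that edge. With one edge in B the sets A counted
-- for the graph are independent in the window. This is the origin of the condition on independent
-- sets, and the condition on cliques is the same one for the complement. The number 27 belongs to
-- 3K₂ twice: it has 3³ independent sets and 3 · 3² sets with exactly one edge. Some graphs offer no
-- such window: in a star every six vertices have at least 33 independent sets. For these sparse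
-- graphs the window is chosen so that the vertices outside it are pairwise non-adjacent, and then a
-- B containing an edge never occurs. The excesses 12, 6, 1 and 0 over 27 count the non-adjacent
-- pairs of 3K₂ with isolated vertices added whose part outside the window is B.

-- Sums over subsets and recursive edge counts

module Counting where

  open import Defs
  open import Data.Bool.Base using (Bool; true; false; not; _∧_; if_then_else_)
  open import Data.Bool.Properties using (∧-zeroʳ)
  open import Data.Fin.Base using (Fin; zero; suc)
  open import Data.Fin.Permutation using (Permutation; _⟨$⟩ʳ_; _⟨$⟩ˡ_; inverseʳ; inverseˡ)
  open import Data.Fin.Properties using (_<?_)
  open import Data.Fin.Subset using (Subset)
  open import Data.Fin.Subset.Properties using (_∈?_)
  open import Data.List.Base as List using (List; []; _∷_; length; filter; allFin; cartesianProduct)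
  open import Data.List.Membership.Propositional.Properties using (∈-map⁺)
  open import Data.List.Membership.Propositional.Properties.WithK using (unique∧set⇒bag)
  open import Data.List.Properties using (filter-++; length-++; map-tabulate; map-∘; map-cong; map-++)
  open import Data.List.Relation.Binary.BagAndSetEquality using (∼bag⇒↭)
  import Data.List.Relation.Binary.Permutation.Propositional.Properties as ↭
  import Data.List.Relation.Unary.Unique.Propositional.Properties as Unique
  open import Data.Nat.Base using (ℕ; zero; suc; _+_; _*_; _≤_; z≤n)
  open import Data.Nat.ListAction using (sum)
  open import Data.Nat.ListAction.Properties using (sum-++; sum-↭)
  open import Data.Nat.Properties hiding (_<?_; _≟_)
  open import Data.Nat.Tactic.RingSolver using (solve-∀)
  open import Data.Product.Base using (_×_; _,_)
  open import Data.Vec.Base using ([]; _∷_; _++_; lookup; tabulate)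
  open import Data.Vec.Properties using (lookup∘tabulate; tabulate∘lookup; tabulate-cong)
  open import Function.Base using (_∘_)
  open import Function.Bundles using (mk⇔)
  open import Relation.Binary.PropositionalEquality
  open import Relation.Nullary.Decidable using (does)
  open import Relation.Unary using (Decidable)
  import Algebra.Properties.CommutativeMonoid.Sum +-0-commutativeMonoid as ∑

  private variable
    k m n : ℕ
    A : Set

  Adjacency : ℕ → Set
  Adjacency n = Fin n → Fin n → Bool

  infix 4 _≐_
  _≐_ : Adjacency n → Adjacency n → Set
  f ≐ g = ∀ u v → f u v ≡ g u v

  co : Adjacency n → Adjacency n
  co f u v = distinct u v ∧ not (f u v)

  below : Adjacency (suc n) → Adjacency n
  below f u v = f (suc u) (suc v)

  ⟦_⟧ : Bool → ℕ
  ⟦ true ⟧ = 1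
  ⟦ false ⟧ = 0

  nbrs : (Fin n → Bool) → Subset n → ℕ
  nbrs g [] = 0
  nbrs g (s ∷ S) = ⟦ s ∧ g zero ⟧ + nbrs (g ∘ suc) S

  edges : Adjacency n → Subset n → ℕ
  edges f [] = 0
  edges f (s ∷ S) = (if s then nbrs (f zero ∘ suc) S else 0) + edges (below f) S

  only : ℕ → ℕ
  only 1 = 1
  only _ = 0

  opaque
    -- Opaque, so that sums over the 64 subsets of the window do not unfold in types; `∑ₛ-sum`
    -- exposes the list where evaluation is wanted.
    ∑ₛ : (Subset n → ℕ) → ℕ
    ∑ₛ {n} F = sum (List.map F (allSubsets n))

    ∑ₛ-sum : (F : Subset n → ℕ) → ∑ₛ F ≡ sum (List.map F (allSubsets n))
    ∑ₛ-sum F = refl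

  σ : Adjacency n → ℕ
  σ f = ∑ₛ (only ∘ edges f)

  nbrs-cong : ∀ {g h : Fin n → Bool} → (∀ v → g v ≡ h v) → ∀ S → nbrs g S ≡ nbrs h S
  nbrs-cong eq [] = refl
  nbrs-cong eq (s ∷ S) = cong₂ _+_ (cong (λ b → ⟦ s ∧ b ⟧) (eq zero)) (nbrs-cong (eq ∘ suc) S)

  edges-cong : ∀ {f g : Adjacency n} → f ≐ g → ∀ S → edges f S ≡ edges g S
  edges-cong eq [] = refl
  edges-cong eq (true ∷ S) = cong₂ _+_ (nbrs-cong (eq zero ∘ suc) S) (edges-cong (λ u v → eq (suc u) (suc v)) S)
  edges-cong eq (false ∷ S) = edges-cong (λ u v → eq (suc u) (suc v)) S

  opaque
    unfolding ∑ₛ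

    ∑ₛ-cong : {F G : Subset n → ℕ} → (∀ S → F S ≡ G S) → ∑ₛ F ≡ ∑ₛ G
    ∑ₛ-cong eq = cong sum (map-cong eq (allSubsets _))

    ∑ₛ-suc : (F : Subset (suc n) → ℕ) → ∑ₛ F ≡ ∑ₛ (F ∘ (false ∷_)) + ∑ₛ (F ∘ (true ∷_))
    ∑ₛ-suc {n} F = begin
      ∑ₛ F
        ≡⟨ cong sum (map-++ F (List.map (false ∷_) (allSubsets n)) _) ⟩
      sum (List.map F (List.map (false ∷_) (allSubsets n)) List.++ List.map F (List.map (true ∷_) (allSubsets n)))
        ≡⟨ sum-++ (List.map F (List.map (false ∷_) (allSubsets n))) _ ⟩
      sum (List.map F (List.map (false ∷_) (allSubsets n))) + sum (List.map F (List.map (true ∷_) (allSubsets n)))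
        ≡⟨ cong₂ (λ x y → sum x + sum y) (map-∘ (allSubsets n)) (map-∘ (allSubsets n)) ⟨
      ∑ₛ (F ∘ (false ∷_)) + ∑ₛ (F ∘ (true ∷_)) ∎
      where open ≡-Reasoning

  +-interchange : ∀ a b c d → (a + b) + (c + d) ≡ (a + c) + (b + d)
  +-interchange = solve-∀

  opaque
    unfolding ∑ₛ

    ∑ₛ-+ : (F G : Subset n → ℕ) → ∑ₛ (λ S → F S + G S) ≡ ∑ₛ F + ∑ₛ G
    ∑ₛ-+ {n} F G = go (allSubsets n)
      where
      go : ∀ xs → sum (List.map (λ S → F S + G S) xs) ≡ sum (List.map F xs) + sum (List.map G xs)
      go [] = refl
      go (S ∷ xs) rewrite go xs = +-interchange (F S) (G S) _ _

    ∑ₛ-mono : {F G : Subset n → ℕ} → (∀ S → F S ≤ G S) → ∑ₛ F ≤ ∑ₛ G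
    ∑ₛ-mono {n} {F} {G} le = go (allSubsets n)
      where
      go : ∀ xs → sum (List.map F xs) ≤ sum (List.map G xs)
      go [] = z≤n
      go (S ∷ xs) = +-mono-≤ (le S) (go xs)

  -- Equality in the theorem is an equality of totals. This localises it to every part B outside the
  -- window, which is all that the equality analysis uses.
  ∑ₛ-tight : {F G : Subset n → ℕ} → (∀ S → F S ≤ G S) → ∑ₛ F ≡ ∑ₛ G → ∀ S → F S ≡ G S
  ∑ₛ-tight {zero} {F} {G} le eq [] = +-cancelʳ-≡ 0 (F []) (G []) (trans (sym (∑ₛ-sum F)) (trans eq (∑ₛ-sum G)))
  ∑ₛ-tight {suc n} {F} {G} le eq (s ∷ S) = half s
    where
    F₀ = ∑ₛ (F ∘ (false ∷_)); F₁ = ∑ₛ (F ∘ (true ∷_))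
    G₀ = ∑ₛ (G ∘ (false ∷_)); G₁ = ∑ₛ (G ∘ (true ∷_))
    eq′ : F₀ + F₁ ≡ G₀ + G₁
    eq′ = trans (sym (∑ₛ-suc F)) (trans eq (∑ₛ-suc G))
    le₀ : F₀ ≤ G₀
    le₀ = ∑ₛ-mono (le ∘ (false ∷_))
    le₁ : F₁ ≤ G₁
    le₁ = ∑ₛ-mono (le ∘ (true ∷_))
    half : ∀ s → F (s ∷ S) ≡ G (s ∷ S)
    half false = ∑ₛ-tight (le ∘ (false ∷_)) (≤-antisym le₀ (+-cancelʳ-≤ F₁ G₀ F₀
      (≤-trans (+-monoʳ-≤ G₀ le₁) (≤-reflexive (sym eq′))))) S
    half true = ∑ₛ-tight (le ∘ (true ∷_)) (≤-antisym le₁ (+-cancelˡ-≤ F₀ G₁ F₁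
      (≤-trans (+-monoˡ-≤ G₁ le₀) (≤-reflexive (sym eq′))))) S

  ∑ₛ-split : ∀ m (F : Subset (m + k) → ℕ) → ∑ₛ F ≡ ∑ₛ (λ (B : Subset k) → ∑ₛ (λ (A : Subset m) → F (A ++ B)))
  ∑ₛ-split {k} zero F = ∑ₛ-cong {k} (λ B → sym (trans (∑ₛ-sum (λ A → F (A ++ B))) (+-identityʳ (F B))))
  ∑ₛ-split {k} (suc m) F = begin
    ∑ₛ F
      ≡⟨ ∑ₛ-suc F ⟩
    ∑ₛ (F ∘ (false ∷_)) + ∑ₛ (F ∘ (true ∷_))
      ≡⟨ cong₂ _+_ (∑ₛ-split m (F ∘ (false ∷_))) (∑ₛ-split m (F ∘ (true ∷_))) ⟩
    ∑ₛ (half false) + ∑ₛ (half true)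
      ≡⟨ ∑ₛ-+ (half false) (half true) ⟨
    ∑ₛ (λ B → half false B + half true B)
      ≡⟨ ∑ₛ-cong {k} (λ B → ∑ₛ-suc {m} (λ A → F (A ++ B))) ⟨
    ∑ₛ (λ (B : Subset k) → ∑ₛ (λ (A : Subset (suc m)) → F (A ++ B))) ∎
    where
    open ≡-Reasoning
    half : Bool → Subset k → ℕ
    half s B = ∑ₛ (λ A → F (s ∷ A ++ B))

  -- Invariance under relabelling of the vertices

  relabel : (Fin m → Fin n) → Subset n → Subset m
  relabel π S = tabulate (lookup S ∘ π)

  relabel-inverse : (π : Fin m → Fin n) (ρ : Fin n → Fin m) → (∀ u → π (ρ u) ≡ u) →
    ∀ S → relabel ρ (relabel π S) ≡ S
  relabel-inverse π ρ inv S = trans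
    (tabulate-cong (λ u → trans (lookup∘tabulate (lookup S ∘ π) (ρ u)) (cong (lookup S) (inv u))))
    (tabulate∘lookup S)

  opaque
    unfolding ∑ₛ

    -- The relabelled list of all subsets still has no repetitions and still contains every subset,
    -- so it is a permutation of the original list.
    ∑ₛ-relabel : (π : Permutation n n) (F : Subset n → ℕ) → ∑ₛ (F ∘ relabel (π ⟨$⟩ʳ_)) ≡ ∑ₛ F
    ∑ₛ-relabel {n} π F = trans (cong sum (map-∘ (allSubsets n))) (sum-↭ (↭.map⁺ F
      (∼bag⇒↭ (unique∧set⇒bag (Unique.map⁺ injective (allSubsets-unique n)) (allSubsets-unique n)
        (λ {S} → mk⇔ (λ _ → allSubsets-complete S)
          (λ _ → subst (_∈ˡ _) (relabel-inverse (π ⟨$⟩ˡ_) (π ⟨$⟩ʳ_) (λ _ → inverseˡ π) S)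
                   (∈-map⁺ _ (allSubsets-complete (relabel (π ⟨$⟩ˡ_) S)))))))))
      where
      open import Data.List.Membership.Propositional using () renaming (_∈_ to _∈ˡ_)
      injective : ∀ {S T} → relabel (π ⟨$⟩ʳ_) S ≡ relabel (π ⟨$⟩ʳ_) T → S ≡ T
      injective {S} {T} eq = begin
        S ≡⟨ relabel-inverse (π ⟨$⟩ʳ_) (π ⟨$⟩ˡ_) (λ _ → inverseʳ π) S ⟨
        _ ≡⟨ cong (relabel (π ⟨$⟩ˡ_)) eq ⟩
        _ ≡⟨ relabel-inverse (π ⟨$⟩ʳ_) (π ⟨$⟩ˡ_) (λ _ → inverseʳ π) T ⟩
        T ∎
        where open ≡-Reasoning

  nbrs-∑ : (g : Fin n → Bool) (S : Subset n) → nbrs g S ≡ ∑.sum (λ v → ⟦ lookup S v ∧ g v ⟧)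
  nbrs-∑ g [] = refl
  nbrs-∑ g (s ∷ S) = cong (⟦ s ∧ g zero ⟧ +_) (nbrs-∑ (g ∘ suc) S)

  ∑-false : ∀ n → ∑.sum {n} (λ _ → 0) ≡ 0
  ∑-false n = ∑.sum-replicate-zero n

  nbrs-if : ∀ s (g : Fin n → Bool) (S : Subset n) →
    (if s then nbrs g S else 0) ≡ ∑.sum (λ v → ⟦ s ∧ lookup S v ∧ g v ⟧)
  nbrs-if true g S = nbrs-∑ g S
  nbrs-if {n} false g S = sym (∑-false n)

  orderedPairs : Adjacency n → Subset n → ℕ
  orderedPairs f S = ∑.sum (λ u → ∑.sum (λ v → ⟦ lookup S u ∧ lookup S v ∧ f u v ⟧))

  exchange : ∀ s t b → s ∧ t ∧ b ≡ t ∧ s ∧ b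
  exchange true _ _ = refl
  exchange false true _ = refl
  exchange false false _ = refl

  -- The recursion in `edges` depends on the order of the vertices. Ordered pairs do not: a
  -- permutation merely reindexes their double sum, and halving recovers the invariance of `edges`.
  edges-twice : (f : Adjacency n) → (∀ u v → f u v ≡ f v u) → (∀ u → f u u ≡ false) →
    ∀ S → orderedPairs f S ≡ edges f S + edges f S
  edges-twice f f-sym f-irr [] = refl
  edges-twice f f-sym f-irr (s ∷ S) = begin
    (⟦ s ∧ s ∧ f zero zero ⟧ + row) + ∑.sum (λ u → ⟦ lookup S u ∧ s ∧ f (suc u) zero ⟧ +
        ∑.sum (λ v → ⟦ lookup S u ∧ lookup S v ∧ f (suc u) (suc v) ⟧))
      ≡⟨ cong₂ (λ x y → (x + row) + y) diagonal (∑.∑-distrib-+ (λ u → ⟦ lookup S u ∧ s ∧ f (suc u) zero ⟧) _) ⟩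
    row + (∑.sum (λ u → ⟦ lookup S u ∧ s ∧ f (suc u) zero ⟧) + orderedPairs (below f) S)
      ≡⟨ cong (λ x → row + (x + orderedPairs (below f) S)) (∑.sum-cong-≗ column) ⟩
    row + (row + orderedPairs (below f) S)
      ≡⟨ cong (λ x → row + (row + x)) (edges-twice (below f) (λ u v → f-sym _ _) (λ u → f-irr _) S) ⟩
    row + (row + (edges (below f) S + edges (below f) S))
      ≡⟨ shuffle row (edges (below f) S) ⟩
    (row + edges (below f) S) + (row + edges (below f) S)
      ≡⟨ cong (λ x → (x + edges (below f) S) + (x + edges (below f) S)) (nbrs-if s (f zero ∘ suc) S) ⟨
    edges f (s ∷ S) + edges f (s ∷ S) ∎
    where
    open ≡-Reasoning
    row = ∑.sum (λ v → ⟦ s ∧ lookup S v ∧ f zero (suc v) ⟧)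
    shuffle : ∀ a b → a + (a + (b + b)) ≡ (a + b) + (a + b)
    shuffle = solve-∀
    diagonal : ⟦ s ∧ s ∧ f zero zero ⟧ ≡ 0
    diagonal rewrite f-irr zero | ∧-zeroʳ s | ∧-zeroʳ s = refl
    column : ∀ u → ⟦ lookup S u ∧ s ∧ f (suc u) zero ⟧ ≡ ⟦ s ∧ lookup S u ∧ f zero (suc u) ⟧
    column u rewrite f-sym (suc u) zero = cong ⟦_⟧ (exchange (lookup S u) s _)

  double-injective : ∀ a b → a + a ≡ b + b → a ≡ b
  double-injective a b eq = *-cancelˡ-≡ a b 2 (trans (double a) (trans eq (sym (double b))))
    where
    double : ∀ a → 2 * a ≡ a + a
    double = solve-∀

  record Simple (f : Adjacency n) : Set where
    constructor simple
    field
      symmetric : ∀ u v → f u v ≡ f v u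
      irreflexive : ∀ u → f u u ≡ false
  open Simple public

  edges-relabel : (π : Permutation n n) {f g : Adjacency n} → Simple f → Simple g →
    (∀ u v → f u v ≡ g (π ⟨$⟩ʳ u) (π ⟨$⟩ʳ v)) → ∀ S → edges f (relabel (π ⟨$⟩ʳ_) S) ≡ edges g S
  edges-relabel π {f} {g} sf sg eq S = double-injective _ _ (begin
    edges f S′ + edges f S′
      ≡⟨ edges-twice f (symmetric sf) (irreflexive sf) S′ ⟨
    ∑.sum (λ u → ∑.sum (λ v → ⟦ lookup S′ u ∧ lookup S′ v ∧ f u v ⟧))
      ≡⟨ ∑.sum-cong-≗ (λ u → ∑.sum-cong-≗ (λ v → cong ⟦_⟧ (cong₂ _∧_ (S′-lookup u) (cong₂ _∧_ (S′-lookup v) (eq u v))))) ⟩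
    ∑.sum (λ u → ∑.sum (λ v → entry (π ⟨$⟩ʳ u) (π ⟨$⟩ʳ v)))
      ≡⟨ ∑.sum-cong-≗ (λ u → ∑.sum-permute (entry (π ⟨$⟩ʳ u)) π) ⟨
    ∑.sum (λ u → ∑.sum (entry (π ⟨$⟩ʳ u)))
      ≡⟨ ∑.sum-permute (λ u → ∑.sum (entry u)) π ⟨
    orderedPairs g S
      ≡⟨ edges-twice g (symmetric sg) (irreflexive sg) S ⟩
    edges g S + edges g S ∎)
    where
    open ≡-Reasoning
    S′ = relabel (π ⟨$⟩ʳ_) S
    S′-lookup = lookup∘tabulate (lookup S ∘ (π ⟨$⟩ʳ_))
    entry : Fin _ → Fin _ → ℕ
    entry u v = ⟦ lookup S u ∧ lookup S v ∧ g u v ⟧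

  ∑ₛ-edges-relabel : (h : ℕ → ℕ) (π : Permutation n n) {f g : Adjacency n} → Simple f → Simple g →
    (∀ u v → f u v ≡ g (π ⟨$⟩ʳ u) (π ⟨$⟩ʳ v)) → ∑ₛ (h ∘ edges f) ≡ ∑ₛ (h ∘ edges g)
  ∑ₛ-edges-relabel h π {f} sf sg eq = trans (sym (∑ₛ-relabel π (h ∘ edges f)))
    (∑ₛ-cong (λ S → cong h (edges-relabel π sf sg eq S)))

  -- Agreement with the list-based definition of the induced edges

  length-filter-tabulate : ∀ {P : A → Set} (P? : Decidable P) (g : Fin n → A) →
    length (filter P? (List.tabulate g)) ≡ ∑.sum (λ i → ⟦ does (P? (g i)) ⟧)
  length-filter-tabulate {n = zero} P? g = refl
  length-filter-tabulate {n = suc n} P? g with does (P? (g zero))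
  ... | true = cong suc (length-filter-tabulate P? (g ∘ suc))
  ... | false = length-filter-tabulate P? (g ∘ suc)

  length-filter-product : {P : Fin n × Fin n → Set} (P? : Decidable P) (g : Fin m → Fin n) →
    length (filter P? (cartesianProduct (List.tabulate g) (allFin n))) ≡
    ∑.sum (λ i → ∑.sum (λ v → ⟦ does (P? (g i , v)) ⟧))
  length-filter-product {m = zero} P? g = refl
  length-filter-product {n} {suc m} P? g = begin
    length (filter P? (List.map (g zero ,_) (allFin n) List.++ rest))
      ≡⟨ cong length (filter-++ P? (List.map (g zero ,_) (allFin n)) rest) ⟩
    length (filter P? (List.map (g zero ,_) (allFin n)) List.++ filter P? rest)
      ≡⟨ length-++ (filter P? (List.map (g zero ,_) (allFin n))) ⟩
    length (filter P? (List.map (g zero ,_) (allFin n))) + length (filter P? rest)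
      ≡⟨ cong₂ _+_ (trans (cong (length ∘ filter P?) (map-tabulate (λ v → v) (g zero ,_)))
                          (length-filter-tabulate P? (g zero ,_)))
                   (length-filter-product P? (g ∘ suc)) ⟩
    _ ∎
    where
    open ≡-Reasoning
    rest = cartesianProduct (List.tabulate (g ∘ suc)) (allFin n)

  ∈?-lookup : (u : Fin n) (S : Subset n) → does (u ∈? S) ≡ lookup S u
  ∈?-lookup zero (true ∷ S) = refl
  ∈?-lookup zero (false ∷ S) = refl
  ∈?-lookup (suc u) (s ∷ S) = ∈?-lookup u S

  increasingPairs : Adjacency n → Subset n → ℕ
  increasingPairs f S = ∑.sum (λ u → ∑.sum (λ v → ⟦ does (u <? v) ∧ lookup S u ∧ lookup S v ∧ f u v ⟧))

  edges-increasing : (f : Adjacency n) (S : Subset n) → increasingPairs f S ≡ edges f S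
  edges-increasing f [] = refl
  edges-increasing f (s ∷ S) = cong₂ _+_ (sym (nbrs-if s (f zero ∘ suc) S)) (edges-increasing (below f) S)

  inducedEdges-edges : (G : Graph n) (S : Subset n) → length (inducedEdges G S) ≡ edges (adj G) S
  inducedEdges-edges G S = trans
    (length-filter-product (inducedEdge? G S) (λ u → u))
    (trans (∑.sum-cong-≗ (λ u → ∑.sum-cong-≗ (λ v → cong (λ b → ⟦ does (u <? v) ∧ b ⟧)
              (cong₂ _∧_ (∈?-lookup u S) (cong₂ _∧_ (∈?-lookup v S) (adj?-adj u v))))))
           (edges-increasing (adj G) S))
    where
    adj?-adj : ∀ u v → does (adj? G u v) ≡ adj G u v
    adj?-adj u v with adj G u v
    ... | true = refl
    ... | false = refl

  σ₁-σ : (G : Graph n) → σ₁ G ≡ σ (adj G)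
  σ₁-σ {n} G = trans (go (allSubsets n)) (sym (∑ₛ-sum (only ∘ edges (adj G))))
    where
    go : ∀ Ss → length (filter (is1NearlyIndependent? G) Ss) ≡ sum (List.map (only ∘ edges (adj G)) Ss)
    go [] = refl
    go (S ∷ Ss) with length (inducedEdges G S) | inducedEdges-edges G S
    ... | 0 | eq rewrite sym eq = go Ss
    ... | 1 | eq rewrite sym eq = cong suc (go Ss)
    ... | suc (suc _) | eq rewrite sym eq = go Ss

-- Branch and bound over edge and non-edge counts

module BranchAndBound where

  open import Defs
  open Counting
  open import Data.Bool.Base using (Bool; true; false; not; _∧_; if_then_else_)
  open import Data.Fin.Base using (Fin; zero; suc; _↑ˡ_; _↑ʳ_)
  open import Data.Fin.Subset using (Subset)
  open import Data.List.Base as List using (List; []; _∷_; length)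
  open import Data.List.Membership.Propositional using (_∈_)
  open import Data.List.Relation.Unary.Any using (here; there)
  open import Data.Nat.Base
  open import Data.Nat.ListAction using (sum)
  open import Data.Nat.Properties hiding (_<?_; _≟_)
  open import Data.Nat.Tactic.RingSolver using (solve-∀)
  open import Data.Product.Base using (_×_; _,_; proj₁; proj₂)
  open import Data.Sum.Base using (_⊎_; inj₁; inj₂)
  open import Data.Vec.Base as Vec using (Vec; []; _∷_; _++_; replicate; tabulate; zip)
  open import Data.Vec.Relation.Binary.Pointwise.Inductive using (Pointwise; []; _∷_)
  open import Function.Base using (_∘_; id)
  open import Relation.Binary.PropositionalEquality

  private variable
    k m n : ℕ

  -- The number n(n-1)/2 of pairs among n vertices.
  tri : ℕ → ℕ
  tri zero = 0
  tri (suc n) = n + tri n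

  -- The indicator of the pairs inside A among all pairs in lexicographic order. It makes the edge
  -- count of A a linear form in the adjacency bits, so a search can fix these bits one at a time.
  pairs : Subset n → Vec Bool (tri n)
  pairs [] = []
  pairs {suc n} (true ∷ A) = A ++ pairs A
  pairs {suc n} (false ∷ A) = replicate n false ++ pairs A

  dot : Vec Bool m → Vec ℕ m → ℕ
  dot [] [] = 0
  dot (true ∷ M) (x ∷ xs) = x + dot M xs
  dot (false ∷ M) (x ∷ xs) = dot M xs

  -- A test set during the search: its numbers of edges and of non-edges decided
  -- so far, and the undecided items (in order) that contribute to it.
  Entry : ℕ → Set
  Entry m = ℕ × ℕ × Vec Bool m

  one : ℕ → ℕ → ℕ
  one 1 _ = 1
  one _ 1 = 1
  one _ _ = 0

  score : Entry m → Vec (ℕ × ℕ) m → ℕ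
  score (e , f , M) ρ = one (e + dot M (Vec.map proj₁ ρ)) (f + dot M (Vec.map proj₂ ρ))

  total : List (Entry m) → Vec (ℕ × ℕ) m → ℕ
  total Es ρ = sum (List.map (λ E → score E ρ) Es)

  none : Vec Bool m → Bool
  none [] = true
  none (true ∷ _) = false
  none (false ∷ M) = none M

  -- Counts only grow, so a dropped entry scores 0 under every continuation: either both counts have
  -- reached two, or nothing is undecided and neither count is one. Whatever might still score is
  -- kept, hence the number of kept entries bounds the total.
  alive : Entry m → Bool
  alive (1 , _ , _) = true
  alive (_ , 1 , _) = true
  alive (suc (suc _) , suc (suc _) , _) = false
  alive (_ , _ , M) = not (none M)

  keep : Entry m → List (Entry m) → List (Entry m)
  keep E Es = if alive E then E ∷ Es else Es

  step : ℕ × ℕ → List (Entry (suc m)) → List (Entry m)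
  step x [] = []
  step x ((e , f , false ∷ M) ∷ Es) = (e , f , M) ∷ step x Es
  step x@(a , b) ((e , f , true ∷ M) ∷ Es) = keep (e + a , f + b , M) (step x Es)

  short : {A : Set} → ℕ → List A → Bool
  short _ [] = true
  short zero (_ ∷ _) = false
  short (suc n) (_ ∷ xs) = short n xs

  Options : ℕ → Set
  Options m = Vec (List (ℕ × ℕ)) m

  -- Branch and bound over all ways to choose an option for every item: a branch
  -- is cut once at most `cap` test sets are alive.
  module Search {l : ℕ} (cap : ℕ) (leaf : Vec (ℕ × ℕ) l → ℕ → Bool) where

    -- `κ` puts the options chosen so far back in front, so that `leaf` is applied to the complete
    -- assignment.
    check : Options m → (Vec (ℕ × ℕ) m → Vec (ℕ × ℕ) l) → List (Entry m) → Bool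
    branch : Options m → (Vec (ℕ × ℕ) m → Vec (ℕ × ℕ) l) → List (Entry m) → Bool
    branches : List (ℕ × ℕ) → Options m → (Vec (ℕ × ℕ) (suc m) → Vec (ℕ × ℕ) l) → List (Entry (suc m)) → Bool
    check os κ Es = if short cap Es then true else branch os κ Es
    branch [] κ Es = if total Es [] ≤ᵇ cap then true else leaf (κ []) (total Es [])
    branch (o ∷ os) κ Es = branches o os κ Es
    branches [] os κ Es = true
    branches (x ∷ xs) os κ Es =
      if check os (κ ∘ (x ∷_)) (step x Es) then branches xs os κ Es else false

  open Search

  one≤1 : ∀ e f → one e f ≤ 1
  one≤1 0 0 = z≤n
  one≤1 0 1 = s≤s z≤n
  one≤1 0 (suc (suc f)) = z≤n
  one≤1 1 f = s≤s z≤n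
  one≤1 (suc (suc e)) 0 = z≤n
  one≤1 (suc (suc e)) 1 = s≤s z≤n
  one≤1 (suc (suc e)) (suc (suc f)) = z≤n

  total≤length : (Es : List (Entry m)) (ρ : Vec (ℕ × ℕ) m) → total Es ρ ≤ length Es
  total≤length [] ρ = z≤n
  total≤length (E ∷ Es) ρ = +-mono-≤ (one≤1 _ _) (total≤length Es ρ)

  short-length : {A : Set} (n : ℕ) (xs : List A) → short n xs ≡ true → length xs ≤ n
  short-length n [] _ = z≤n
  short-length (suc n) (_ ∷ xs) eq = s≤s (short-length n xs eq)

  dot-none : (M : Vec Bool m) → none M ≡ true → ∀ xs → dot M xs ≡ 0
  dot-none [] _ [] = refl
  dot-none (false ∷ M) eq (x ∷ xs) = dot-none M eq xs

  not-alive-none : ∀ e f → one e f ≡ 0 → (M : Vec Bool m) (ρ : Vec (ℕ × ℕ) m) →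
    not (none M) ≡ false → score (e , f , M) ρ ≡ 0
  not-alive-none e f eq M ρ dead with none M in M-none
  ... | true rewrite dot-none M M-none (Vec.map proj₁ ρ) | dot-none M M-none (Vec.map proj₂ ρ)
                   | +-identityʳ e | +-identityʳ f = eq

  score-dead : (E : Entry m) → alive E ≡ false → ∀ ρ → score E ρ ≡ 0
  score-dead (0 , 0 , M) dead ρ = not-alive-none 0 0 refl M ρ dead
  score-dead (0 , suc (suc f) , M) dead ρ = not-alive-none 0 (suc (suc f)) refl M ρ dead
  score-dead (suc (suc e) , 0 , M) dead ρ = not-alive-none (suc (suc e)) 0 refl M ρ dead
  score-dead (suc (suc e) , suc (suc f) , M) dead ρ = refl

  total-keep : (E : Entry m) (Es : List (Entry m)) (ρ : Vec (ℕ × ℕ) m) →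
    total (keep E Es) ρ ≡ score E ρ + total Es ρ
  total-keep E Es ρ with alive E in eq
  ... | true = refl
  ... | false rewrite score-dead E eq ρ = refl

  total-step : (Es : List (Entry (suc m))) (x : ℕ × ℕ) (ρ : Vec (ℕ × ℕ) m) →
    total (step x Es) ρ ≡ total Es (x ∷ ρ)
  total-step [] x ρ = refl
  total-step ((e , f , false ∷ M) ∷ Es) x ρ = cong (score (e , f , M) ρ +_) (total-step Es x ρ)
  total-step ((e , f , true ∷ M) ∷ Es) x@(a , b) ρ = begin
    total (keep (e + a , f + b , M) (step x Es)) ρ
      ≡⟨ total-keep (e + a , f + b , M) (step x Es) ρ ⟩
    score (e + a , f + b , M) ρ + total (step x Es) ρ
      ≡⟨ cong₂ _+_ (cong₂ one (+-assoc e a _) (+-assoc f b _)) (total-step Es x ρ) ⟩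
    score (e , f , true ∷ M) (x ∷ ρ) + total Es (x ∷ ρ) ∎
    where open ≡-Reasoning

  if-true : ∀ {a b} → (if a then b else false) ≡ true → a ≡ true × b ≡ true
  if-true {true} {true} _ = refl , refl

  module _ {l : ℕ} (cap : ℕ) (leaf : Vec (ℕ × ℕ) l → ℕ → Bool) where

    Bounded : (Vec (ℕ × ℕ) m → Vec (ℕ × ℕ) l) → List (Entry m) → Vec (ℕ × ℕ) m → Set
    Bounded κ Es ρ = total Es ρ ≤ cap ⊎ leaf (κ ρ) (total Es ρ) ≡ true

    check-sound : (os : Options m) (κ : Vec (ℕ × ℕ) m → Vec (ℕ × ℕ) l) (Es : List (Entry m)) →
      check cap leaf os κ Es ≡ true → ∀ {ρ} → Pointwise _∈_ ρ os → Bounded κ Es ρ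
    branches-sound : (xs : List (ℕ × ℕ)) (os : Options m) (κ : Vec (ℕ × ℕ) (suc m) → Vec (ℕ × ℕ) l)
      (Es : List (Entry (suc m))) → branches cap leaf xs os κ Es ≡ true →
      ∀ {x ρ} → x ∈ xs → Pointwise _∈_ ρ os → Bounded κ Es (x ∷ ρ)
    check-sound os κ Es eq {ρ} valid with short cap Es in eq′
    ... | true = inj₁ (≤-trans (total≤length Es ρ) (short-length cap Es eq′))
    check-sound [] κ Es eq [] | false with total Es [] ≤ᵇ cap in eq″
    ... | true = inj₁ (≤ᵇ⇒≤ _ _ (subst Data.Bool.Base.T (sym eq″) _))
    ... | false = inj₂ eq
    check-sound (o ∷ os) κ Es eq (x∈o ∷ valid) | false = branches-sound o os κ Es eq x∈o valid
    branches-sound (x ∷ xs) os κ Es eq {ρ = ρ} (here refl) valid =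
      subst (λ t → t ≤ cap ⊎ leaf (κ (x ∷ ρ)) t ≡ true) (total-step Es x ρ)
        (check-sound os (κ ∘ (x ∷_)) (step x Es) (proj₁ (if-true eq)) valid)
    branches-sound (x ∷ xs) os κ Es eq (there x∈xs) valid =
      branches-sound xs os κ Es (proj₂ (if-true {check cap leaf os (κ ∘ (x ∷_)) (step x Es)} eq)) x∈xs valid

    search-sound : (os : Options l) (Es : List (Entry l)) → check cap leaf os id Es ≡ true →
      ∀ {ρ} → Pointwise _∈_ ρ os → ∀ {t} → t ≡ total Es ρ → t ≤ cap ⊎ leaf ρ t ≡ true
    search-sound os Es eq valid refl = check-sound os id Es eq valid

  -- Every A starts with the `e` edges and `f` non-edges that lie inside B.
  testSets : ℕ → ℕ → (Subset 6 → Vec Bool m) → List (Entry m)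
  testSets e f M = List.foldr keep [] (List.map (λ A → e , f , M A) (allSubsets 6))

  total-testSets : ∀ e f (M : Subset 6 → Vec Bool m) ρ →
    total (testSets e f M) ρ ≡ ∑ₛ (λ A → score (e , f , M A) ρ)
  total-testSets e f M ρ = trans (go (allSubsets 6)) (sym (∑ₛ-sum _))
    where
    go : ∀ As → total (List.foldr keep [] (List.map (λ A → e , f , M A) As)) ρ ≡
                sum (List.map (λ A → score (e , f , M A) ρ) As)
    go [] = refl
    go (A ∷ As) = trans (total-keep (e , f , M A) _ ρ) (cong (score (e , f , M A) ρ +_) (go As))

  pairsOf : Adjacency n → Vec ℕ (tri n)
  pairsOf {zero} f = []
  pairsOf {suc n} f = tabulate (⟦_⟧ ∘ f zero ∘ suc) ++ pairsOf (below f)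

  cross : ∀ m → Adjacency (m + k) → Subset k → Vec ℕ m
  cross zero f B = []
  cross (suc m) f B = nbrs (f zero ∘ (suc m ↑ʳ_)) B ∷ cross m (below f) B

  left : ∀ m → Adjacency (m + k) → Adjacency m
  left {k} m f u v = f (u ↑ˡ k) (v ↑ˡ k)

  right : ∀ m → Adjacency (m + k) → Adjacency k
  right m f u v = f (m ↑ʳ u) (m ↑ʳ v)

  dot-++ : (M : Vec Bool m) (N : Vec Bool n) (xs : Vec ℕ m) (ys : Vec ℕ n) →
    dot (M ++ N) (xs ++ ys) ≡ dot M xs + dot N ys
  dot-++ [] N [] ys = refl
  dot-++ (true ∷ M) N (x ∷ xs) ys = trans (cong (x +_) (dot-++ M N xs ys)) (sym (+-assoc x _ _))
  dot-++ (false ∷ M) N (x ∷ xs) ys = dot-++ M N xs ys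

  dot-nbrs : (g : Fin n → Bool) (A : Subset n) → dot A (tabulate (⟦_⟧ ∘ g)) ≡ nbrs g A
  dot-nbrs g [] = refl
  dot-nbrs g (true ∷ A) = cong (⟦ g zero ⟧ +_) (dot-nbrs (g ∘ suc) A)
  dot-nbrs g (false ∷ A) = dot-nbrs (g ∘ suc) A

  dot-false : (xs : Vec ℕ n) → dot (replicate n false) xs ≡ 0
  dot-false [] = refl
  dot-false (x ∷ xs) = dot-false xs

  edges-dot : (f : Adjacency n) (A : Subset n) → dot (pairs A) (pairsOf f) ≡ edges f A
  edges-dot f [] = refl
  edges-dot f (true ∷ A) = trans (dot-++ A (pairs A) _ _) (cong₂ _+_ (dot-nbrs _ A) (edges-dot (below f) A))
  edges-dot {suc n} f (false ∷ A) = trans (dot-++ (replicate n false) (pairs A) _ _)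
    (cong₂ _+_ (dot-false (tabulate {n = n} (⟦_⟧ ∘ f zero ∘ suc))) (edges-dot (below f) A))

  nbrs-++ : (g : Fin (m + k) → Bool) (A : Subset m) (B : Subset k) →
    nbrs g (A ++ B) ≡ nbrs (g ∘ (_↑ˡ k)) A + nbrs (g ∘ (m ↑ʳ_)) B
  nbrs-++ g [] B = refl
  nbrs-++ g (s ∷ A) B = trans (cong (⟦ s ∧ g zero ⟧ +_) (nbrs-++ (g ∘ suc) A B)) (sym (+-assoc ⟦ s ∧ g zero ⟧ _ _))

  edges-++ : ∀ {m} (f : Adjacency (m + k)) (A : Subset m) (B : Subset k) →
    edges f (A ++ B) ≡ edges (right m f) B + (dot A (cross m f B) + edges (left m f) A)
  edges-++ f [] B = sym (+-identityʳ _)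
  edges-++ {m = suc m} f (false ∷ A) B = edges-++ (below f) A B
  edges-++ {k} {suc m} f (true ∷ A) B = trans
    (cong₂ _+_ (nbrs-++ (f zero ∘ suc) A B) (edges-++ (below f) A B))
    (shuffle (nbrs (f zero ∘ suc ∘ (_↑ˡ k)) A) _ (edges (right (suc m) f) B)
      (dot A (cross m (below f) B)) (edges (left m (below f)) A))
    where
    shuffle : ∀ a b r c l → (a + b) + (r + (c + l)) ≡ r + ((b + c) + (a + l))
    shuffle = solve-∀

  -- B affects the edge count of A ∪ B only through its own edges and the degrees of the window
  -- vertices into it. For a window of six vertices this leaves 21 values: six degrees, then fifteen
  -- adjacency bits.
  values : ∀ m → Adjacency (m + k) → Subset k → Vec ℕ (m + tri m)
  values m f B = cross m f B ++ pairsOf (left m f)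

  edges-values : ∀ {m} (f : Adjacency (m + k)) (A : Subset m) (B : Subset k) →
    edges f (A ++ B) ≡ edges (right m f) B + dot (A ++ pairs A) (values m f B)
  edges-values {m = m} f A B = trans (edges-++ f A B) (cong (edges (right m f) B +_)
    (trans (cong (dot A (cross m f B) +_) (sym (edges-dot (left m f) A))) (sym (dot-++ A (pairs A) _ _))))

  assignment : Adjacency (6 + k) → Subset k → Vec (ℕ × ℕ) 21
  assignment f B = zip (values 6 f B) (values 6 (co f) B)

  -- The number of sets A inside the six-vertex window for which A ∪ B induces
  -- exactly one edge or exactly one non-edge.
  count : Adjacency (6 + k) → Subset k → ℕ
  count f B = ∑ₛ {6} (λ A → one (edges f (A ++ B)) (edges (co f) (A ++ B)))

-- The finite computations on the window

module WindowChecks where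

  open import Defs hiding (_∨_)
  open Counting
  open BranchAndBound
  open import Data.Bool.Base using (Bool; true; false; not; _∧_; _∨_)
  open import Data.Bool.ListAction using (all)
  open import Data.Fin.Base using (zero; suc)
  open import Data.Fin.Patterns
  open import Data.Fin.Permutation as Perm using (Permutation′; _∘ₚ_; _⟨$⟩ʳ_)
  open import Data.Fin.Subset using (Subset; ∁; ⁅_⁆)
  open import Data.List.Base as List using (List; []; _∷_; allFin)
  open import Data.List.Relation.Unary.Any using (any?)
  open import Data.Nat.Base
  open import Data.Nat.ListAction using (sum)
  import Data.Nat.Properties as ℕ
  open import Data.Product.Base using (_×_; _,_; proj₁; proj₂)
  open import Data.Vec.Base as Vec using (Vec; []; _∷_; _++_; replicate; take; drop)
  open import Data.Vec.Properties using (≡-dec)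
  open import Function.Base using (id)
  open import Relation.Binary.PropositionalEquality
  open import Relation.Nullary.Decidable using (does)

  private variable
    n : ℕ

  clear : Vec Bool n → Vec ℕ n → Bool
  clear [] [] = true
  clear (true ∷ M) (zero ∷ xs) = clear M xs
  clear (true ∷ M) (suc _ ∷ xs) = false
  clear (false ∷ M) (_ ∷ xs) = clear M xs

  independentSets : Vec ℕ 15 → ℕ
  independentSets h = sum (List.map (λ A → ⟦ clear (pairs A) h ⟧) (allSubsets 6))

  zeros positives : Vec ℕ n → Bool
  zeros [] = true
  zeros (zero ∷ xs) = zeros xs
  zeros (suc _ ∷ xs) = false
  positives [] = true
  positives (zero ∷ xs) = false
  positives (suc _ ∷ xs) = positives xs

  goodVec : Vec ℕ 15 → Vec ℕ 15 → Bool
  goodVec h h′ = (independentSets h ≤ᵇ 27) ∧ (independentSets h′ ≤ᵇ 27)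

  starVec : Vec ℕ 6 → Vec ℕ 15 → Bool
  starVec (_ ∷ c) h = zeros c ∧ positives (take 5 h) ∧ zeros (drop 5 h)

  -- What remains visible of `Window` in the 21 values. For non-empty B, an excess over the bound is
  -- accepted only where this test fails.
  admissible : Vec (ℕ × ℕ) 21 → Bool
  admissible ρ = goodVec (drop 6 es) (drop 6 (Vec.map proj₂ ρ)) ∨ zeros (take 6 es) ∨ starVec (take 6 es) (drop 6 es)
    where es = Vec.map proj₁ ρ

  bit : List (ℕ × ℕ)
  bit = (1 , 0) ∷ (0 , 1) ∷ []

  options : List (ℕ × ℕ) → Options 21
  options o = replicate 6 o ++ replicate 15 bit

  -- The fifteen perfect matchings of the window: 3K₂ pulled back along
  -- transpositions bringing the partner of 0 to 1 and then the partner of 2 to 3.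
  matchingPermutations : List (Permutation′ 6)
  matchingPermutations = List.concatMap
    (λ a → List.map (λ b → Perm.transpose 1F a ∘ₚ Perm.transpose 3F b) (3F ∷ 4F ∷ 5F ∷ []))
    (1F ∷ 2F ∷ 3F ∷ 4F ∷ 5F ∷ [])

  matching : Permutation′ 6 → Adjacency 6
  matching π u v = adj 3K₂ (π ⟨$⟩ʳ u) (π ⟨$⟩ʳ v)

  matchingVec : Vec ℕ 15 → Bool
  matchingVec h = does (any? (λ π → ≡-dec ℕ._≟_ h (pairsOf (matching π))) matchingPermutations)

  -- The lexicographic order of the pairs is 01 02 03 04 05 12 13 14 15 23 24 25 34 35 45.
  twoAttached : Vec ℕ 15 → Bool
  twoAttached (e01 ∷ e02 ∷ e03 ∷ e04 ∷ e05 ∷ e12 ∷ e13 ∷ e14 ∷ e15 ∷ e23 ∷ _ ∷ _ ∷ _ ∷ _ ∷ e45 ∷ []) =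
    (1 ≤ᵇ e23) ∧ (1 ≤ᵇ e45) ∧ ((1 ≤ᵇ e01) ∨
      ((1 ≤ᵇ e02 + (e03 + (e04 + e05))) ∧ (1 ≤ᵇ e12 + (e13 + (e14 + e15)))))

  -- `leaf₀` and `leaf₁` are run with a cap one below the bounds 39 and 33, so they also describe
  -- the assignments that attain these bounds. Eight edges are more than half of the fifteen pairs:
  -- this alternative makes room for the complement of 3K₂, which has twelve edges, and is
  -- impossible for 3K₂, which has three.
  leaf₀ leaf₁ leaf₂ : Vec (ℕ × ℕ) 21 → ℕ → Bool
  leaf₀ ρ t = (t ≤ᵇ 39) ∧ (matchingVec (drop 6 (Vec.map proj₁ ρ)) ∨ matchingVec (drop 6 (Vec.map proj₂ ρ)))
  leaf₁ ρ t = not (admissible ρ) ∨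
    ((t ≤ᵇ 33) ∧ (zeros (take 6 es) ∨ (8 ≤ᵇ Vec.sum (drop 6 es))))
    where es = Vec.map proj₁ ρ
  leaf₂ ρ _ = not (admissible ρ)

  -- The last condition makes it possible to exchange a window vertex for another one:
  -- see `exchange-vertex`.
  leafᵢ : Vec (ℕ × ℕ) 15 → ℕ → Bool
  leafᵢ ρ _ = not (twoAttached h) ∧ all (λ a → dot (pairs (∁ ⁅ a ⁆)) h ≤ᵇ 4) (allFin 6)
    where h = Vec.map proj₁ ρ

  -- The first three list the possible numbers of edges and non-edges from a window vertex to a B
  -- with 0, 1 or 2 vertices. In `opts₃` the degree is cut off at 2 and non-edges are recorded as 0,
  -- because B alone already supplies two of them.
  opts₀ opts₁ opts₂ opts₃ : List (ℕ × ℕ)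
  opts₀ = (0 , 0) ∷ []
  opts₁ = (1 , 0) ∷ (0 , 1) ∷ []
  opts₂ = (2 , 0) ∷ (1 , 1) ∷ (0 , 2) ∷ []
  opts₃ = (2 , 0) ∷ (1 , 0) ∷ (0 , 0) ∷ []

  windowPairs : Subset 6 → Vec Bool 21
  windowPairs A = A ++ pairs A

  -- For B = ∅ nothing is required of the window: this is the case n = 6 of the theorem, including
  -- its two extremal graphs.
  check₀ : Search.check 38 leaf₀ (options opts₀) id (testSets 0 0 windowPairs) ≡ true
  check₀ = refl

  check₁ : Search.check 32 leaf₁ (options opts₁) id (testSets 0 0 windowPairs) ≡ true
  check₁ = refl

  -- The initial non-edge says that the two vertices of B are non-adjacent. An adjacent pair is
  -- treated through the complement, or does not occur when the graph is sparse.
  check₂ : Search.check 28 leaf₂ (options opts₂) id (testSets 0 1 windowPairs) ≡ true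
  check₂ = refl

  -- Two initial non-edges stand for any larger number: they rule out the second alternative in
  -- `one`, so only sets with exactly one edge are counted.
  check₃ : Search.check 27 leaf₂ (options opts₃) id (testSets 0 2 windowPairs) ≡ true
  check₃ = refl

  -- With one edge and two non-edges granted in advance, A scores exactly when it adds no edge. The
  -- same search thereby counts independent sets.
  checkᵢ : Search.check 27 leafᵢ (replicate 15 bit) id (testSets 1 2 pairs) ≡ true
  checkᵢ = refl

-- From the computations to bounds for a given window

module WindowBounds where

  open import Defs hiding (_∨_)
  open Counting
  open BranchAndBound
  open WindowChecks
  open import Data.Bool.Base using (Bool; true; false; not; _∧_; _∨_; T)
  open import Data.Bool.Properties using (not-involutive)
  open import Data.Fin.Base using (Fin; zero; suc; _↑ˡ_; _↑ʳ_)
  open import Data.Fin.Patterns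
  open import Data.Fin.Subset using (Subset; ∣_∣)
  open import Data.Fin.Properties using (_≟_; ↑ˡ-injective; ↑ʳ-injective)
  open import Data.List.Base using (List; []; _∷_)
  open import Data.List.Membership.Propositional using (_∈_)
  open import Data.List.Properties using (map-cong)
  open import Data.List.Relation.Unary.Any using (here; there)
  open import Data.Nat.Base
  open import Data.Nat.ListAction using (sum)
  open import Data.Nat.Properties hiding (_<?_; _≟_)
  open import Data.Product.Base using (_×_; _,_; proj₁; proj₂)
  open import Data.Sum.Base using (_⊎_; inj₁; inj₂)
  open import Data.Vec.Base as Vec using (Vec; []; _∷_; _++_; replicate; zip)
  open import Data.Vec.Properties using (map-proj₁-zip; map-proj₂-zip; map-id)
  open import Data.Vec.Relation.Binary.Pointwise.Inductive using (Pointwise; []; _∷_)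
  open import Function.Base using (_∘_; id)
  open import Relation.Binary.PropositionalEquality
  open import Relation.Nullary.Decidable using (yes; no; dec-true; dec-false)

  private variable
    k m n : ℕ

  free : ℕ → ℕ
  free 0 = 1
  free (suc _) = 0

  indep : Adjacency n → ℕ
  indep f = ∑ₛ (free ∘ edges f)

  clear-free : (M : Vec Bool n) (xs : Vec ℕ n) → ⟦ clear M xs ⟧ ≡ free (dot M xs)
  clear-free [] [] = refl
  clear-free (true ∷ M) (zero ∷ xs) = clear-free M xs
  clear-free (true ∷ M) (suc _ ∷ xs) = refl
  clear-free (false ∷ M) (_ ∷ xs) = clear-free M xs

  independentSets-indep : (f : Adjacency 6) → independentSets (pairsOf f) ≡ indep f
  independentSets-indep f = trans
    (cong sum (map-cong (λ A → trans (clear-free (pairs A) (pairsOf f)) (cong free (edges-dot f A))) (allSubsets 6)))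
    (sym (∑ₛ-sum (free ∘ edges f)))

  T⇒≡ : ∀ {b} → T b → b ≡ true
  T⇒≡ {true} _ = refl

  ≡⇒T : ∀ {b} → b ≡ true → T b
  ≡⇒T refl = _

  ∧-true : ∀ {a b} → a ∧ b ≡ true → a ≡ true × b ≡ true
  ∧-true {true} eq = refl , eq

  ≤⇒≤ᵇ-true : ∀ {a b} → a ≤ b → (a ≤ᵇ b) ≡ true
  ≤⇒≤ᵇ-true le = T⇒≡ (≤⇒≤ᵇ le)

  ≤ᵇ-true⇒≤ : ∀ {a b} → (a ≤ᵇ b) ≡ true → a ≤ b
  ≤ᵇ-true⇒≤ eq = ≤ᵇ⇒≤ _ _ (≡⇒T eq)

  nbrs-not : (g : Fin n → Bool) (S : Subset n) → nbrs g S + nbrs (not ∘ g) S ≡ ∣ S ∣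
  nbrs-not g [] = refl
  nbrs-not g (false ∷ S) = nbrs-not (g ∘ suc) S
  nbrs-not g (true ∷ S) with g zero
  ... | true = cong suc (nbrs-not (g ∘ suc) S)
  ... | false = trans (+-suc _ _) (cong suc (nbrs-not (g ∘ suc) S))

  edges-co : (f : Adjacency n) (S : Subset n) → edges f S + edges (co f) S ≡ tri ∣ S ∣
  edges-co f [] = refl
  edges-co f (false ∷ S) = edges-co (below f) S
  edges-co f (true ∷ S) = trans (+-interchange (nbrs (f zero ∘ suc) S) _ _ _)
    (cong₂ _+_ (nbrs-not (f zero ∘ suc) S) (edges-co (below f) S))

  distinct-injective : (g : Fin m → Fin n) → (∀ {u v} → g u ≡ g v → u ≡ v) →
    ∀ u v → distinct (g u) (g v) ≡ distinct u v
  distinct-injective g inj u v with u ≟ v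
  ... | yes refl = cong not (dec-true (g u ≟ g u) refl)
  ... | no u≢v = cong not (dec-false (g u ≟ g v) (u≢v ∘ inj))

  left-co : (f : Adjacency (m + k)) → left m (co f) ≐ co (left m f)
  left-co {k = k} f u v = cong (_∧ not (f (u ↑ˡ k) (v ↑ˡ k))) (distinct-injective (_↑ˡ k) (↑ˡ-injective k _ _) u v)

  right-co : ∀ m (f : Adjacency (m + k)) → right m (co f) ≐ co (right m f)
  right-co m f u v = cong (_∧ not (f (m ↑ʳ u) (m ↑ʳ v))) (distinct-injective (m ↑ʳ_) (↑ʳ-injective m _ _) u v)

  co-co : {f : Adjacency n} → Simple f → co (co f) ≐ f
  co-co {f = f} sf u v with u ≟ v
  ... | yes refl = sym (irreflexive sf u)
  ... | no _ = not-involutive (f u v)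

  co-cong : {f g : Adjacency n} → f ≐ g → co f ≐ co g
  co-cong eq u v = cong (λ b → distinct u v ∧ not b) (eq u v)

  co-Simple : {f : Adjacency n} → Simple f → Simple (co f)
  co-Simple sf = simple (λ u v → cong₂ _∧_ (distinct-sym u v) (cong not (symmetric sf u v)))
                        (λ u → cong (_∧ not _) (distinct-irrefl u))

  left-Simple : ∀ m {f : Adjacency (m + k)} → Simple f → Simple (left m f)
  left-Simple m sf = simple (λ u v → symmetric sf _ _) (λ u → irreflexive sf _)

  record Good (f : Adjacency (6 + k)) : Set where
    constructor good
    field
      few-independent : indep (left 6 f) ≤ 27
      few-cliques : indep (co (left 6 f)) ≤ 27

  -- The graphs all of whose six-vertex subgraphs may have too many independent sets:
  -- either every edge lies in the window, or all edges meet the vertex 0.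
  data Sparse (f : Adjacency (6 + k)) : Set where
    isolated : (∀ j u → f (6 ↑ʳ j) u ≡ false) → Sparse f
    star : (∀ u v → u ≢ 0F → v ≢ 0F → f u v ≡ false) → (∀ (i : Fin 5) → f 0F (suc (i ↑ˡ k)) ≡ true) → Sparse f

  Window : Adjacency (6 + k) → Set
  Window f = Good f ⊎ Sparse f

  indep-cong : {f g : Adjacency n} → f ≐ g → indep f ≡ indep g
  indep-cong eq = ∑ₛ-cong (λ S → cong free (edges-cong eq S))

  Good-co : {f : Adjacency (6 + k)} → Simple f → Good f → Good (co f)
  Good-co {f = f} sf (good i c) = good
    (≤-trans (≤-reflexive (indep-cong (left-co f))) c)
    (≤-trans (≤-reflexive (indep-cong λ u v → trans (co-cong (left-co f) u v) (co-co (left-Simple 6 sf) u v))) i)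

  bit∈ : ∀ b → (⟦ b ⟧ , ⟦ not b ⟧) ∈ bit
  bit∈ true = here refl
  bit∈ false = there (here refl)

  pairs-valid : (f : Adjacency 6) → Pointwise _∈_ (zip (pairsOf f) (pairsOf (co f))) (replicate 15 bit)
  pairs-valid f =
    bit∈ (f 0F 1F) ∷ bit∈ (f 0F 2F) ∷ bit∈ (f 0F 3F) ∷ bit∈ (f 0F 4F) ∷ bit∈ (f 0F 5F) ∷
    bit∈ (f 1F 2F) ∷ bit∈ (f 1F 3F) ∷ bit∈ (f 1F 4F) ∷ bit∈ (f 1F 5F) ∷ bit∈ (f 2F 3F) ∷
    bit∈ (f 2F 4F) ∷ bit∈ (f 2F 5F) ∷ bit∈ (f 3F 4F) ∷ bit∈ (f 3F 5F) ∷ bit∈ (f 4F 5F) ∷ []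

  degrees : Adjacency (6 + k) → Subset k → Fin 6 → ℕ × ℕ
  degrees {k} f B i = nbrs (f (i ↑ˡ k) ∘ (6 ↑ʳ_)) B , nbrs (co f (i ↑ˡ k) ∘ (6 ↑ʳ_)) B

  degrees-sum : (f : Adjacency (6 + k)) (B : Subset k) (i : Fin 6) →
    proj₁ (degrees f B i) + proj₂ (degrees f B i) ≡ ∣ B ∣
  degrees-sum {k} f B i = trans
    (cong (nbrs g B +_) (nbrs-cong (λ v → cong (_∧ not (g v)) (apart i v)) B)) (nbrs-not g B)
    where
    g = f (i ↑ˡ k) ∘ (6 ↑ʳ_)
    apart : ∀ i v → distinct (i ↑ˡ _) (6 ↑ʳ v) ≡ true
    apart 0F v = refl
    apart 1F v = refl
    apart 2F v = refl
    apart 3F v = refl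
    apart 4F v = refl
    apart 5F v = refl

  assignment-valid : (f : Adjacency (6 + k)) (B : Subset k) {o : List (ℕ × ℕ)} →
    (∀ i → degrees f B i ∈ o) → Pointwise _∈_ (assignment f B) (options o)
  assignment-valid f B d = d 0F ∷ d 1F ∷ d 2F ∷ d 3F ∷ d 4F ∷ d 5F ∷ pairs-valid (left 6 f)

  ∈opts₀ : ∀ x y → x + y ≡ 0 → (x , y) ∈ opts₀
  ∈opts₀ 0 0 _ = here refl

  ∈opts₁ : ∀ x y → x + y ≡ 1 → (x , y) ∈ opts₁
  ∈opts₁ 0 1 _ = there (here refl)
  ∈opts₁ 1 0 _ = here refl
  ∈opts₁ 0 (suc (suc _)) ()
  ∈opts₁ (suc (suc _)) _ ()

  ∈opts₂ : ∀ x y → x + y ≡ 2 → (x , y) ∈ opts₂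
  ∈opts₂ 0 2 _ = there (there (here refl))
  ∈opts₂ 1 1 _ = there (here refl)
  ∈opts₂ 2 0 _ = here refl
  ∈opts₂ 0 0 ()
  ∈opts₂ 0 1 ()
  ∈opts₂ 0 (suc (suc (suc _))) ()
  ∈opts₂ 1 (suc (suc _)) ()

  zero-nbrs : (g : Fin n → Bool) → (∀ v → g v ≡ false) → ∀ S → nbrs g S ≡ 0
  zero-nbrs g eq [] = refl
  zero-nbrs g eq (true ∷ S) rewrite eq zero = zero-nbrs (g ∘ suc) (eq ∘ suc) S
  zero-nbrs g eq (false ∷ S) = zero-nbrs (g ∘ suc) (eq ∘ suc) S

  zero-edges : (f : Adjacency n) → (∀ u v → f u v ≡ false) → ∀ S → edges f S ≡ 0
  zero-edges f eq [] = refl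
  zero-edges f eq (true ∷ S) rewrite zero-nbrs (f zero ∘ suc) (λ v → eq _ _) S = zero-edges (below f) (λ u v → eq _ _) S
  zero-edges f eq (false ∷ S) = zero-edges (below f) (λ u v → eq _ _) S

  admissibleParts : Vec ℕ 6 → Vec ℕ 15 → Vec ℕ 15 → Bool
  admissibleParts c h h′ = goodVec h h′ ∨ zeros c ∨ starVec c h

  ∨-trueʳ : ∀ a {b} → b ≡ true → a ∨ b ≡ true
  ∨-trueʳ true _ = refl
  ∨-trueʳ false eq = eq

  zeros-true : (xs : Vec ℕ n) → Pointwise _≡_ xs (replicate n 0) → zeros xs ≡ true
  zeros-true [] [] = refl
  zeros-true (.0 ∷ xs) (refl ∷ eqs) = zeros-true xs eqs

  admissible-good : ∀ c h h′ → independentSets h ≤ 27 → independentSets h′ ≤ 27 → admissibleParts c h h′ ≡ true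
  admissible-good c h h′ i i′ = cong (_∨ (zeros c ∨ starVec c h)) (cong₂ _∧_ (≤⇒≤ᵇ-true i) (≤⇒≤ᵇ-true i′))

  admissible-zeros : ∀ c h h′ → zeros c ≡ true → admissibleParts c h h′ ≡ true
  admissible-zeros c h h′ eq = ∨-trueʳ (goodVec h h′) (cong (_∨ starVec c h) eq)

  admissible-star : ∀ c h h′ → starVec c h ≡ true → admissibleParts c h h′ ≡ true
  admissible-star c h h′ eq = ∨-trueʳ (goodVec h h′) (∨-trueʳ (zeros c) eq)

  -- `t` is the identity or truncation at 2.
  admissible-window : (t : ℕ → ℕ) → t 0 ≡ 0 → {f : Adjacency (6 + k)} → Simple f → Window f → ∀ B →
    admissibleParts (Vec.map t (cross 6 f B)) (pairsOf (left 6 f)) (pairsOf (co (left 6 f))) ≡ true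
  admissible-window t t0 {f} sf (inj₁ (good i c)) B =
    admissible-good (Vec.map t (cross 6 f B)) (pairsOf (left 6 f)) (pairsOf (co (left 6 f)))
      (≤-trans (≤-reflexive (independentSets-indep (left 6 f))) i)
      (≤-trans (≤-reflexive (independentSets-indep (co (left 6 f)))) c)
  admissible-window {k} t t0 {f} sf (inj₂ (isolated iso)) B =
    admissible-zeros (Vec.map t (cross 6 f B)) (pairsOf (left 6 f)) (pairsOf (co (left 6 f)))
      (zeros-true (Vec.map t (cross 6 f B)) (d 0F ∷ d 1F ∷ d 2F ∷ d 3F ∷ d 4F ∷ d 5F ∷ []))
    where
    d : ∀ i → t (nbrs (f (i ↑ˡ k) ∘ (6 ↑ʳ_)) B) ≡ 0
    d i = trans (cong t (zero-nbrs _ (λ v → trans (symmetric sf _ _) (iso v _)) B)) t0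
  admissible-window {k} t t0 {f} sf (inj₂ (star off on)) B =
    admissible-star (Vec.map t (cross 6 f B)) (pairsOf (left 6 f)) (pairsOf (co (left 6 f))) starTrue
    where
    d : ∀ (i : Fin 5) → t (nbrs (f (suc (i ↑ˡ k)) ∘ (6 ↑ʳ_)) B) ≡ 0
    d i = trans (cong t (zero-nbrs _ (λ v → off _ _ (λ ()) (λ ())) B)) t0
    z : ∀ (i j : Fin 5) → ⟦ f (suc (i ↑ˡ k)) (suc (j ↑ˡ k)) ⟧ ≡ 0
    z i j = cong ⟦_⟧ (off (suc (i ↑ˡ k)) (suc (j ↑ˡ k)) (λ ()) (λ ()))
    starTrue : starVec (Vec.map t (cross 6 f B)) (pairsOf (left 6 f)) ≡ true
    starTrue
      rewrite d 0F | d 1F | d 2F | d 3F | d 4F | on 0F | on 1F | on 2F | on 3F | on 4F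
            | z 0F 1F | z 0F 2F | z 0F 3F | z 0F 4F | z 1F 2F | z 1F 3F | z 1F 4F | z 2F 3F | z 2F 4F | z 3F 4F = refl

  admissible-assignment : {f : Adjacency (6 + k)} → Simple f → Window f → ∀ B → admissible (assignment f B) ≡ true
  admissible-assignment {f = f} sf w B = trans
    (cong₂ (λ es es′ → admissibleParts (Vec.take 6 es) (Vec.drop 6 es) (Vec.drop 6 es′))
      (map-proj₁-zip (values 6 f B) (values 6 (co f) B)) (map-proj₂-zip (values 6 f B) (values 6 (co f) B)))
    (subst (λ c → admissibleParts c (pairsOf (left 6 f)) (pairsOf (co (left 6 f))) ≡ true)
      (map-id (cross 6 f B)) (admissible-window id refl sf w B))

  true-not : ∀ {b} {A : Set} → b ≡ true → not b ≡ true → A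
  true-not refl ()

  one-sym : ∀ e f → one e f ≡ one f e
  one-sym 0 0 = refl
  one-sym 0 1 = refl
  one-sym 0 (suc (suc f)) = refl
  one-sym 1 0 = refl
  one-sym 1 1 = refl
  one-sym 1 (suc (suc f)) = refl
  one-sym (suc (suc e)) 0 = refl
  one-sym (suc (suc e)) 1 = refl
  one-sym (suc (suc e)) (suc (suc f)) = refl

  count-co : {f : Adjacency (6 + k)} → Simple f → ∀ B → count (co f) B ≡ count f B
  count-co {f = f} sf B = ∑ₛ-cong {6} (λ A →
    trans (cong (one (edges (co f) (A ++ B))) (edges-cong (co-co sf) (A ++ B)))
          (one-sym (edges (co f) (A ++ B)) (edges f (A ++ B))))

  count-window : ∀ e e′ (f : Adjacency (6 + k)) (B : Subset k) → edges (right 6 f) B ≡ e → edges (right 6 (co f)) B ≡ e′ →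
    count f B ≡ ∑ₛ (λ A → score (e , e′ , windowPairs A) (assignment f B))
  count-window e e′ f B refl refl = ∑ₛ-cong (λ A → cong₂ one
    (trans (edges-values f A B)
      (cong (λ v → edges (right 6 f) B + dot (windowPairs A) v) (sym (map-proj₁-zip (values 6 f B) (values 6 (co f) B)))))
    (trans (edges-values (co f) A B)
      (cong (λ v → edges (right 6 (co f)) B + dot (windowPairs A) v) (sym (map-proj₂-zip (values 6 f B) (values 6 (co f) B))))))

  count-from : ∀ e e′ (f : Adjacency (6 + k)) (B : Subset k) → edges (right 6 f) B ≡ e → edges (right 6 (co f)) B ≡ e′ →
    count f B ≡ total (testSets e e′ windowPairs) (assignment f B)
  count-from e e′ f B p q = trans (count-window e e′ f B p q) (sym (total-testSets e e′ windowPairs (assignment f B)))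

  edges-∅ : (f : Adjacency n) (S : Subset n) → ∣ S ∣ ≡ 0 → edges f S ≡ 0
  edges-∅ f S eq = m+n≡0⇒m≡0 (edges f S) (trans (edges-co f S) (cong tri eq))

  right-co-edges : (f : Adjacency (6 + k)) (B : Subset k) → edges (right 6 f) B + edges (right 6 (co f)) B ≡ tri ∣ B ∣
  right-co-edges f B = trans (cong (edges (right 6 f) B +_) (edges-cong (right-co 6 f) B)) (edges-co (right 6 f) B)

  bound₀ : (f : Adjacency (6 + k)) (B : Subset k) → ∣ B ∣ ≡ 0 →
    count f B ≤ 38 ⊎ leaf₀ (assignment f B) (count f B) ≡ true
  bound₀ f B size = search-sound 38 leaf₀ (options opts₀) (testSets 0 0 windowPairs) check₀
    (assignment-valid f B (λ i → ∈opts₀ _ _ (trans (degrees-sum f B i) size))) eq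
    where
    eq : count f B ≡ total (testSets 0 0 windowPairs) (assignment f B)
    eq = count-from 0 0 f B (edges-∅ (right 6 f) B size) (edges-∅ (right 6 (co f)) B size)

  bound₁ : (f : Adjacency (6 + k)) (B : Subset k) → ∣ B ∣ ≡ 1 →
    count f B ≤ 32 ⊎ leaf₁ (assignment f B) (count f B) ≡ true
  bound₁ f B size = search-sound 32 leaf₁ (options opts₁) (testSets 0 0 windowPairs) check₁
    (assignment-valid f B (λ i → ∈opts₁ _ _ (trans (degrees-sum f B i) size))) eq
    where
    e+e′ : edges (right 6 f) B + edges (right 6 (co f)) B ≡ 0
    e+e′ = trans (right-co-edges f B) (cong tri size)
    eq : count f B ≡ total (testSets 0 0 windowPairs) (assignment f B)
    eq = count-from 0 0 f B (m+n≡0⇒m≡0 _ e+e′) (m+n≡0⇒n≡0 (edges (right 6 f) B) e+e′)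

  bound₂ : {f : Adjacency (6 + k)} → Simple f → Window f → (B : Subset k) → ∣ B ∣ ≡ 2 →
    edges (right 6 f) B ≡ 0 → edges (right 6 (co f)) B ≡ 1 → count f B ≤ 28
  bound₂ {f = f} sf w B size e e′ with
    search-sound 28 leaf₂ (options opts₂) (testSets 0 1 windowPairs) check₂
      (assignment-valid f B (λ i → ∈opts₂ _ _ (trans (degrees-sum f B i) size))) (count-from 0 1 f B e e′)
  ... | inj₁ le = le
  ... | inj₂ bad = true-not (admissible-assignment sf w B) bad

-- The upper bound

module UpperBound where

  open import Defs hiding (_∨_; _∪_)
  open Counting
  open BranchAndBound
  open WindowChecks
  open WindowBounds
  open import Data.Bool.Base using (Bool; true; false; not; _∧_; _∨_)
  open import Data.Empty using (⊥-elim)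
  open import Data.Fin.Base using (Fin; zero; suc; _↑ˡ_; _↑ʳ_)
  open import Data.Fin.Patterns
  open import Data.Fin.Subset using (Subset; ∣_∣)
  open import Data.List.Base using ([]; _∷_)
  open import Data.List.Membership.Propositional using (_∈_)
  open import Data.List.Relation.Unary.Any using (here; there)
  open import Data.Nat.Base
  open import Data.Nat.ListAction using (sum)
  open import Data.Nat.Properties hiding (_<?_)
  open import Data.Nat.Tactic.RingSolver using (solve-∀)
  open import Data.Product.Base using (_×_; _,_; proj₁; proj₂)
  open import Data.Sum.Base using (_⊎_; inj₁; inj₂)
  open import Data.Vec.Base as Vec using (Vec; []; _∷_; _++_; replicate; zip)
  open import Data.Vec.Properties using (map-proj₁-zip; map-proj₂-zip)
  open import Data.Vec.Relation.Binary.Pointwise.Inductive using (Pointwise; []; _∷_)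
  open import Function.Base using (_∘_)
  open import Relation.Binary.PropositionalEquality

  private variable
    k m n : ℕ

  one-only : ∀ e {f} → 2 ≤ f → one e f ≡ only e
  one-only 0 (s≤s (s≤s _)) = refl
  one-only 1 (s≤s (s≤s _)) = refl
  one-only (suc (suc e)) (s≤s (s≤s _)) = refl

  only-⊓ : ∀ a → only a ≡ only (2 ⊓ a)
  only-⊓ 0 = refl
  only-⊓ 1 = refl
  only-⊓ (suc (suc a)) = refl

  ⊓-+ : ∀ a b → 2 ⊓ (a + b) ≡ 2 ⊓ ((2 ⊓ a) + b)
  ⊓-+ 0 b = refl
  ⊓-+ 1 b = refl
  ⊓-+ (suc (suc a)) b = refl

  -- The summand `b` makes the induction work: each truncated entry is moved into it before the
  -- remaining vector is treated.
  ⊓-dot : ∀ (M : Vec Bool n) xs b → 2 ⊓ (dot M xs + b) ≡ 2 ⊓ (dot M (Vec.map (2 ⊓_) xs) + b)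
  ⊓-dot [] [] b = refl
  ⊓-dot (true ∷ M) (x ∷ xs) b = begin
    2 ⊓ (x + dot M xs + b)                 ≡⟨ cong (2 ⊓_) (+-assoc x _ b) ⟩
    2 ⊓ (x + (dot M xs + b))               ≡⟨ ⊓-+ x _ ⟩
    2 ⊓ (2 ⊓ x + (dot M xs + b))           ≡⟨ cong (2 ⊓_) (swap (2 ⊓ x) (dot M xs) b) ⟩
    2 ⊓ (dot M xs + (2 ⊓ x + b))           ≡⟨ ⊓-dot M xs (2 ⊓ x + b) ⟩
    2 ⊓ (dot M (Vec.map (2 ⊓_) xs) + (2 ⊓ x + b)) ≡⟨ cong (2 ⊓_) (swap (dot M (Vec.map (2 ⊓_) xs)) (2 ⊓ x) b) ⟩
    2 ⊓ (2 ⊓ x + (dot M (Vec.map (2 ⊓_) xs) + b)) ≡⟨ cong (2 ⊓_) (+-assoc (2 ⊓ x) _ b) ⟨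
    2 ⊓ (2 ⊓ x + dot M (Vec.map (2 ⊓_) xs) + b) ∎
    where
    open ≡-Reasoning
    swap : ∀ a b c → a + (b + c) ≡ b + (a + c)
    swap = solve-∀
  ⊓-dot (false ∷ M) (x ∷ xs) b = ⊓-dot M xs b

  edges-right-≤ : (f : Adjacency (6 + k)) (A : Subset 6) (B : Subset k) → edges (right 6 f) B ≤ edges f (A ++ B)
  edges-right-≤ f A B = ≤-trans (m≤m+n _ _) (≤-reflexive (sym (edges-++ f A B)))

  -- Outside neighbours beyond the second are irrelevant, since two edges already
  -- rule a set out; the truncation makes the search finite.
  truncated : Adjacency (6 + k) → Subset k → Vec (ℕ × ℕ) 21
  truncated f B = zip (Vec.map (2 ⊓_) (cross 6 f B) ++ pairsOf (left 6 f)) (replicate 6 0 ++ pairsOf (left 6 (co f)))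

  truncated-valid : (f : Adjacency (6 + k)) (B : Subset k) → Pointwise _∈_ (truncated f B) (options opts₃)
  truncated-valid {k} f B = d 0F ∷ d 1F ∷ d 2F ∷ d 3F ∷ d 4F ∷ d 5F ∷ pairs-valid (left 6 f)
    where
    ∈opts₃ : ∀ x → (2 ⊓ x , 0) ∈ opts₃
    ∈opts₃ 0 = there (there (here refl))
    ∈opts₃ 1 = there (here refl)
    ∈opts₃ (suc (suc x)) = here refl
    d : (i : Fin 6) → (2 ⊓ nbrs (f (i ↑ˡ k) ∘ (6 ↑ʳ_)) B , 0) ∈ opts₃
    d i = ∈opts₃ _

  count-truncated : (f : Adjacency (6 + k)) (B : Subset k) → edges (right 6 f) B ≡ 0 → 2 ≤ edges (right 6 (co f)) B →
    count f B ≡ total (testSets 0 2 windowPairs) (truncated f B)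
  count-truncated f B e e′ = trans (∑ₛ-cong per) (sym (total-testSets 0 2 windowPairs (truncated f B)))
    where
    open ≡-Reasoning
    c = Vec.map (2 ⊓_) (cross 6 f B)
    h = pairsOf (left 6 f)
    per : ∀ A → one (edges f (A ++ B)) (edges (co f) (A ++ B)) ≡ score (0 , 2 , windowPairs A) (truncated f B)
    per A = begin
      one (edges f (A ++ B)) (edges (co f) (A ++ B))
        ≡⟨ one-only _ (≤-trans e′ (edges-right-≤ (co f) A B)) ⟩
      only (edges f (A ++ B))
        ≡⟨ cong only (trans (edges-++ f A B) (cong (_+ (dot A (cross 6 f B) + edges (left 6 f) A)) e)) ⟩
      only (dot A (cross 6 f B) + edges (left 6 f) A)
        ≡⟨ only-⊓ _ ⟩
      only (2 ⊓ (dot A (cross 6 f B) + edges (left 6 f) A))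
        ≡⟨ cong only (⊓-dot A (cross 6 f B) _) ⟩
      only (2 ⊓ (dot A c + edges (left 6 f) A))
        ≡⟨ only-⊓ _ ⟨
      only (dot A c + edges (left 6 f) A)
        ≡⟨ cong (λ x → only (dot A c + x)) (edges-dot (left 6 f) A) ⟨
      only (dot A c + dot (pairs A) h)
        ≡⟨ cong only (dot-++ A (pairs A) c h) ⟨
      only (dot (windowPairs A) (c ++ h))
        ≡⟨ cong (only ∘ dot (windowPairs A)) (map-proj₁-zip (c ++ h) (replicate 6 0 ++ pairsOf (left 6 (co f)))) ⟨
      only (dot (windowPairs A) (Vec.map proj₁ (truncated f B)))
        ≡⟨ one-only _ {2 + dot (windowPairs A) (Vec.map proj₂ (truncated f B))} (s≤s (s≤s z≤n)) ⟨
      score (0 , 2 , windowPairs A) (truncated f B) ∎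

  admissible-truncated : {f : Adjacency (6 + k)} → Simple f → Window f → ∀ B → admissible (truncated f B) ≡ true
  admissible-truncated {f = f} sf w B = trans
    (cong₂ (λ es es′ → admissibleParts (Vec.take 6 es) (Vec.drop 6 es) (Vec.drop 6 es′))
      (map-proj₁-zip es es′) (map-proj₂-zip es es′))
    (admissible-window (2 ⊓_) refl sf w B)
    where
    es = Vec.map (2 ⊓_) (cross 6 f B) ++ pairsOf (left 6 f)
    es′ = replicate 6 0 ++ pairsOf (left 6 (co f))

  bound₃ : {f : Adjacency (6 + k)} → Simple f → Window f → (B : Subset k) →
    edges (right 6 f) B ≡ 0 → 2 ≤ edges (right 6 (co f)) B → count f B ≤ 27
  bound₃ {f = f} sf w B e e′ with
    search-sound 27 leaf₂ (options opts₃) (testSets 0 2 windowPairs) check₃ (truncated-valid f B) (count-truncated f B e e′)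
  ... | inj₁ le = le
  ... | inj₂ bad = true-not (admissible-truncated sf w B) bad

  -- This is why a sparse graph can do without a bound on independent sets: the cases in which B
  -- contains an edge are vacuous.
  Sparse-right : {f : Adjacency (6 + k)} → Sparse f → ∀ B → edges (right 6 f) B ≡ 0
  Sparse-right (isolated iso) = zero-edges _ (λ u v → iso _ _)
  Sparse-right (star off _) = zero-edges _ (λ u v → off _ _ (λ ()) (λ ()))

  tri-≥3 : ∀ s → 3 ≤ tri (3 + s)
  tri-≥3 s = +-mono-≤ {2} {2 + s} {1} (s≤s (s≤s z≤n)) (s≤s z≤n)

  -- The edge inside B uses up the only one allowed, so a counted A must be independent. The edges
  -- from A to B can only lower the count and are ignored.
  bound-one-edge : {f : Adjacency (6 + k)} → Good f → (B : Subset k) →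
    edges (right 6 f) B ≡ 1 → 2 ≤ edges (right 6 (co f)) B → count f B ≤ 27
  bound-one-edge {f = f} (good i _) B e e′ = ≤-trans (∑ₛ-mono per) i
    where
    only-suc : ∀ a b → only (suc (a + b)) ≤ free b
    only-suc zero zero = s≤s z≤n
    only-suc zero (suc b) = z≤n
    only-suc (suc a) b = z≤n
    per : ∀ A → one (edges f (A ++ B)) (edges (co f) (A ++ B)) ≤ free (edges (left 6 f) A)
    per A = begin
      one (edges f (A ++ B)) (edges (co f) (A ++ B))
        ≡⟨ one-only _ (≤-trans e′ (edges-right-≤ (co f) A B)) ⟩
      only (edges f (A ++ B))
        ≡⟨ cong only (trans (edges-++ f A B) (cong (_+ (dot A (cross 6 f B) + edges (left 6 f) A)) e)) ⟩
      only (suc (dot A (cross 6 f B) + edges (left 6 f) A))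
        ≤⟨ only-suc (dot A (cross 6 f B)) _ ⟩
      free (edges (left 6 f) A) ∎
      where open ≤-Reasoning

  one-large : ∀ {e f} → 2 ≤ e → 2 ≤ f → one e f ≡ 0
  one-large (s≤s (s≤s _)) (s≤s (s≤s _)) = refl

  -- 27 = 3 · 3² is the count for 3K₂; the extras come from the complement and add
  -- up to n(n-1)/2 - 3.
  cap extra : ℕ → ℕ
  cap s = 27 + extra s
  extra 0 = 12
  extra 1 = 6
  extra 2 = 1
  extra (suc (suc (suc _))) = 0

  -- At least three vertices in B give at least three pairs, so one of the two
  -- colours is already ruled out by B alone.
  bound-many : {f : Adjacency (6 + k)} → Simple f → Window f → (B : Subset k) → 3 ≤ ∣ B ∣ →
    ∀ e e′ → edges (right 6 f) B ≡ e → edges (right 6 (co f)) B ≡ e′ → 3 ≤ e + e′ → count f B ≤ 27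
  bound-many sf w B size 0 e′ p q le = bound₃ sf w B p (≤-trans (n≤1+n 2) (subst (3 ≤_) (sym q) le))
  bound-many sf (inj₁ g) B size 1 e′ p q (s≤s le) = bound-one-edge g B p (subst (2 ≤_) (sym q) le)
  bound-many sf (inj₂ sp) B size (suc e) e′ p q le with () ← trans (sym p) (Sparse-right sp B)
  bound-many {f = f} sf (inj₁ g) B size e@(suc (suc _)) 0 p q le =
    ≤-trans (≤-reflexive (sym (count-co sf B))) (bound₃ (co-Simple sf) (inj₁ (Good-co sf g)) B q
      (subst (2 ≤_) (sym (trans (edges-cong (λ u v → co-co sf _ _) B) p)) (s≤s (s≤s z≤n))))
  bound-many {f = f} sf (inj₁ g) B size e@(suc (suc _)) 1 p q le =
    ≤-trans (≤-reflexive (sym (count-co sf B))) (bound-one-edge (Good-co sf g) B q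
      (subst (2 ≤_) (sym (trans (edges-cong (λ u v → co-co sf _ _) B) p)) (s≤s (s≤s z≤n))))
  bound-many {f = f} sf (inj₁ g) B size (suc (suc e)) (suc (suc e′)) p q le = ≤-trans (≤-reflexive
    (trans (∑ₛ-cong {6} {G = λ _ → 0} (λ A → one-large
      (≤-trans (subst (2 ≤_) (sym p) (s≤s (s≤s z≤n))) (edges-right-≤ f A B))
      (≤-trans (subst (2 ≤_) (sym q) (s≤s (s≤s z≤n))) (edges-right-≤ (co f) A B))))
      (∑ₛ-sum {6} (λ _ → 0)))) z≤n

  ∧∨-true : ∀ {a b c} → a ≡ true → not a ∨ (b ∧ c) ≡ true → b ≡ true × c ≡ true
  ∧∨-true refl eq = ∧-true eq

  leaf₁-sound : ∀ ρ t → admissible ρ ≡ true → leaf₁ ρ t ≡ true →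
    t ≤ 33 × (zeros (Vec.take 6 (Vec.map proj₁ ρ)) ≡ true ⊎ 8 ≤ Vec.sum (Vec.drop 6 (Vec.map proj₁ ρ)))
  leaf₁-sound ρ t adm eq with ∧∨-true adm eq
  ... | le , eq′ = ≤ᵇ-true⇒≤ le , split eq′
    where
    split : ∀ {a b} → a ∨ (8 ≤ᵇ b) ≡ true → a ≡ true ⊎ 8 ≤ b
    split {true} _ = inj₁ refl
    split {false} eq = inj₂ (≤ᵇ-true⇒≤ eq)

  leaf₀-sound : ∀ ρ t → leaf₀ ρ t ≡ true →
    t ≤ 39 × (matchingVec (Vec.drop 6 (Vec.map proj₁ ρ)) ≡ true ⊎ matchingVec (Vec.drop 6 (Vec.map proj₂ ρ)) ≡ true)
  leaf₀-sound ρ t eq with ∧-true eq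
  ... | le , eq′ = ≤ᵇ-true⇒≤ le , split (matchingVec (Vec.drop 6 (Vec.map proj₁ ρ))) eq′
    where
    split : ∀ a {b} → a ∨ b ≡ true → a ≡ true ⊎ b ≡ true
    split true _ = inj₁ refl
    split false eq = inj₂ eq

  count≤cap : {f : Adjacency (6 + k)} → Simple f → Window f → ∀ B s → ∣ B ∣ ≡ s → count f B ≤ cap s
  count≤cap {f = f} sf w B 0 size with bound₀ f B size
  ... | inj₁ le = ≤-trans le (n≤1+n 38)
  ... | inj₂ eq = proj₁ (leaf₀-sound (assignment f B) _ eq)
  count≤cap {f = f} sf w B 1 size with bound₁ f B size
  ... | inj₁ le = ≤-trans le (n≤1+n 32)
  ... | inj₂ eq = proj₁ (leaf₁-sound (assignment f B) _ (admissible-assignment sf w B) eq)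
  count≤cap {f = f} sf w B 2 size = go w _ _ refl refl (trans (right-co-edges f B) (cong tri size))
    where
    go : Window f → ∀ e e′ → edges (right 6 f) B ≡ e → edges (right 6 (co f)) B ≡ e′ → e + e′ ≡ 1 → count f B ≤ 28
    go w 0 1 p q _ = bound₂ sf w B size p q
    go (inj₂ sp) 1 0 p q _ with () ← trans (sym p) (Sparse-right sp B)
    go (inj₁ g) 1 0 p q _ = ≤-trans (≤-reflexive (sym (count-co sf B))) (bound₂ (co-Simple sf) (inj₁ (Good-co sf g)) B size q
      (trans (edges-cong (λ u v → co-co sf _ _) B) p))
    go w 0 (suc (suc _)) p q ()
    go w (suc (suc _)) _ p q ()
  count≤cap {f = f} sf w B (suc (suc (suc s))) size = bound-many sf w B (subst (3 ≤_) (sym size) (s≤s (s≤s (s≤s z≤n)))) _ _ refl refl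
    (subst (3 ≤_) (sym (trans (right-co-edges f B) (cong tri size))) (tri-≥3 s))

  ∑ₛ-const : ∀ k c → ∑ₛ {k} (λ _ → c) ≡ c * 2 ^ k
  ∑ₛ-const zero c = trans (∑ₛ-sum {0} (λ _ → c)) (trans (+-identityʳ c) (sym (*-identityʳ c)))
  ∑ₛ-const (suc k) c = trans (∑ₛ-suc {k} (λ _ → c)) (trans (cong₂ _+_ (∑ₛ-const k c) (∑ₛ-const k c)) (double c (2 ^ k)))
    where
    double : ∀ c p → c * p + c * p ≡ c * (p + (p + 0))
    double = solve-∀

  -- The offset `j` counts vertices already put into B. Deciding one further vertex then gives a
  -- recursion of Pascal type, which stops at `j` = 3, where `extra` vanishes.
  extras : ∀ k j → ℕ
  extras k j = ∑ₛ {k} (λ B → extra (j + ∣ B ∣))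

  extras-suc : ∀ k j → extras (suc k) j ≡ extras k j + extras k (suc j)
  extras-suc k j = trans (∑ₛ-suc {k} _) (cong (extras k j +_) (∑ₛ-cong {k} (λ B → cong extra (+-suc j _))))

  extras-zero : ∀ j → extras 0 j ≡ extra j
  extras-zero j = trans (∑ₛ-sum {0} (λ B → extra (j + ∣ B ∣))) (trans (+-identityʳ _) (cong extra (+-identityʳ j)))

  extras₃ : ∀ k j → extras k (3 + j) ≡ 0
  extras₃ zero j = extras-zero (3 + j)
  extras₃ (suc k) j = trans (extras-suc k (3 + j)) (cong₂ _+_ (extras₃ k j) (extras₃ k (suc j)))

  extras₂ : ∀ k → extras k 2 ≡ 1
  extras₂ zero = extras-zero 2
  extras₂ (suc k) = trans (extras-suc k 2) (cong₂ _+_ (extras₂ k) (extras₃ k 0))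

  extras₁ : ∀ k → extras k 1 ≡ 6 + k
  extras₁ zero = extras-zero 1
  extras₁ (suc k) = trans (extras-suc k 1) (trans (cong₂ _+_ (extras₁ k) (extras₂ k)) (+-comm (6 + k) 1))

  extras₀ : ∀ k → extras k 0 ≡ 12 + (6 * k + tri k)
  extras₀ zero = extras-zero 0
  extras₀ (suc k) = trans (extras-suc k 0) (trans (cong₂ _+_ (extras₀ k) (extras₁ k)) (rearrange k (tri k)))
    where
    rearrange : ∀ k t → (12 + (6 * k + t)) + (6 + k) ≡ 12 + (6 * suc k + (k + t))
    rearrange = solve-∀

  maximum : ℕ → ℕ
  maximum k = 27 * 2 ^ k + (12 + (6 * k + tri k))

  ∑-cap : ∀ k → ∑ₛ {k} (λ B → cap ∣ B ∣) ≡ maximum k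
  ∑-cap k = trans (∑ₛ-+ {k} (λ _ → 27) (λ B → extra ∣ B ∣)) (cong₂ _+_ (∑ₛ-const k 27) (extras₀ k))

  σσ : Adjacency n → ℕ
  σσ f = σ f + σ (co f)

  tri≢2 : ∀ s → tri s ≢ 2
  tri≢2 0 ()
  tri≢2 1 ()
  tri≢2 2 ()
  tri≢2 (suc (suc (suc s))) eq with s≤s (s≤s ()) ← subst (3 ≤_) eq (tri-≥3 s)

  -- A set counted for both the graph and its complement would span one edge and one non-edge, hence
  -- two pairs in all; `tri≢2` excludes that, so nothing is counted twice.
  one-split : ∀ e f → e + f ≢ 2 → only e + only f ≡ one e f
  one-split 0 0 _ = refl
  one-split 0 1 _ = refl
  one-split 0 (suc (suc f)) _ = refl
  one-split 1 0 _ = refl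
  one-split 1 1 ne = ⊥-elim (ne refl)
  one-split 1 (suc (suc f)) _ = refl
  one-split (suc (suc e)) 0 _ = refl
  one-split (suc (suc e)) 1 _ = refl
  one-split (suc (suc e)) (suc (suc f)) _ = refl

  σσ-count : (f : Adjacency (6 + k)) → σσ f ≡ ∑ₛ (count f)
  σσ-count {k} f = begin
    σ f + σ (co f)
      ≡⟨ ∑ₛ-+ (only ∘ edges f) (only ∘ edges (co f)) ⟨
    ∑ₛ (λ S → only (edges f S) + only (edges (co f) S))
      ≡⟨ ∑ₛ-cong (λ S → one-split (edges f S) (edges (co f) S) (tri≢2 ∣ S ∣ ∘ trans (sym (edges-co f S)))) ⟩
    ∑ₛ (λ S → one (edges f S) (edges (co f) S))
      ≡⟨ ∑ₛ-split 6 (λ S → one (edges f S) (edges (co f) S)) ⟩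
    ∑ₛ (count f) ∎
    where open ≡-Reasoning

  σσ≤maximum : {f : Adjacency (6 + k)} → Simple f → Window f → σσ f ≤ maximum k
  σσ≤maximum {k} {f} sf w = ≤-trans (≤-reflexive (σσ-count f))
    (≤-trans (∑ₛ-mono (λ B → count≤cap sf w B _ refl)) (≤-reflexive (∑-cap k)))

  σσ-tight : {f : Adjacency (6 + k)} → Simple f → Window f → σσ f ≡ maximum k → ∀ B → count f B ≡ cap ∣ B ∣
  σσ-tight {k} {f} sf w eq = ∑ₛ-tight (λ B → count≤cap sf w B _ refl)
    (trans (sym (σσ-count f)) (trans eq (sym (∑-cap k))))

-- The case of equality

module Equality where

  open import Defs hiding (_∨_; _∪_)
  open Counting
  open BranchAndBound
  open WindowChecks
  open WindowBounds
  open UpperBound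
  open import Data.Bool.Base using (Bool; true; false)
  open import Data.Empty using (⊥-elim)
  open import Data.Fin.Base using (Fin; zero; suc; _↑ˡ_; _↑ʳ_)
  open import Data.Fin.Patterns
  open import Data.Fin.Permutation using (Permutation′; _⟨$⟩ʳ_)
  open import Data.Fin.Properties using (_≟_)
  open import Data.Fin.Subset using (Subset; ∣_∣; ⊥; ⁅_⁆)
  open import Data.Fin.Subset.Properties using (∣⊥∣≡0; ∣⁅x⁆∣≡1)
  open import Data.List.Base as List using (List; []; _∷_)
  open import Data.List.Membership.Propositional using (_∈_; find)
  open import Data.List.Relation.Unary.All as All using (All)
  import Data.List.Relation.Unary.Any as Any
  open import Data.Nat.Base
  open import Data.Nat.ListAction using (sum)
  open import Data.Nat.Properties hiding (_<?_; _≟_)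
  import Data.Nat.Properties as ℕ
  open import Data.Product.Base using (_×_; _,_; proj₁; proj₂; ∃-syntax)
  open import Data.Sum.Base using (_⊎_; inj₁; inj₂; [_,_]′)
  open import Data.Vec.Base as Vec using (Vec; []; _∷_; _++_; replicate; lookup; tabulate)
  open import Data.Vec.Properties using (map-proj₁-zip; map-proj₂-zip; ++-injective; ∷-injective; ≡-dec; tabulate-cong)
  open import Data.Vec.Relation.Binary.Pointwise.Inductive using ([]; _∷_; Pointwise-≡⇒≡)
  open import Function.Base using (_∘_)
  open import Relation.Binary.PropositionalEquality
  open import Relation.Nullary.Decidable using (Dec; does; toWitness; _×-dec_; yes)

  private variable
    k m n : ℕ

  -- The value of `count` for a window `h` without edges to a B of `s` vertices: every window vertex
  -- then has all `s` of them as non-neighbours, and `e`, `e′` are the edges and non-edges within B.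
  countOf : Adjacency 6 → ℕ → ℕ → ℕ → ℕ
  countOf h e e′ s = sum (List.map
    (λ A → one (e + edges h A) (e′ + (dot A (replicate 6 s) + edges (co h) A))) (allSubsets 6))

  record Apart (f : Adjacency (6 + k)) : Set where
    constructor apart
    field no-cross : ∀ (i : Fin 6) j → f (i ↑ˡ k) (6 ↑ʳ j) ≡ false
  open Apart

  cross-apart : (f : Adjacency (6 + k)) → Apart f → ∀ B → cross 6 f B ≡ replicate 6 0
  cross-apart f (apart a) B = Pointwise-≡⇒≡ (d 0F ∷ d 1F ∷ d 2F ∷ d 3F ∷ d 4F ∷ d 5F ∷ [])
    where
    d : ∀ i → nbrs (f (i ↑ˡ _) ∘ (6 ↑ʳ_)) B ≡ 0
    d i = zero-nbrs _ (a i) B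

  cross-co-apart : (f : Adjacency (6 + k)) → Apart f → ∀ B → cross 6 (co f) B ≡ replicate 6 ∣ B ∣
  cross-co-apart f (apart a) B = Pointwise-≡⇒≡ (d 0F ∷ d 1F ∷ d 2F ∷ d 3F ∷ d 4F ∷ d 5F ∷ [])
    where
    d : ∀ i → nbrs (co f (i ↑ˡ _) ∘ (6 ↑ʳ_)) B ≡ ∣ B ∣
    d i = trans (cong (_+ proj₂ (degrees f B i)) (sym (zero-nbrs _ (a i) B))) (degrees-sum f B i)

  dot-zeros : (M : Vec Bool n) → dot M (replicate n 0) ≡ 0
  dot-zeros [] = refl
  dot-zeros (true ∷ M) = dot-zeros M
  dot-zeros (false ∷ M) = dot-zeros M

  count-apart : ∀ (f : Adjacency (6 + k)) {h} → Apart f → left 6 f ≐ h → ∀ B →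
    count f B ≡ countOf h (edges (right 6 f) B) (edges (right 6 (co f)) B) ∣ B ∣
  count-apart f {h} a eq B = trans (∑ₛ-cong per) (∑ₛ-sum _)
    where
    per : ∀ A → one (edges f (A ++ B)) (edges (co f) (A ++ B)) ≡
      one (edges (right 6 f) B + edges h A) (edges (right 6 (co f)) B + (dot A (replicate 6 ∣ B ∣) + edges (co h) A))
    per A = cong₂ one
      (trans (edges-++ f A B) (cong (edges (right 6 f) B +_) (cong₂ _+_
        (trans (cong (dot A) (cross-apart f a B)) (dot-zeros A)) (edges-cong eq A))))
      (trans (edges-++ (co f) A B) (cong (edges (right 6 (co f)) B +_) (cong₂ _+_
        (cong (dot A) (cross-co-apart f a B))
        (edges-cong (λ u v → trans (left-co f u v) (co-cong eq u v)) A))))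

  -- Evaluated for all fifteen matchings. The first two facts make the window good, the third
  -- excludes the eight-edge alternative of `leaf₁`, and the fourth is one short of the 28 that
  -- equality requires when B has two vertices.
  matching-facts : All (λ π → independentSets (pairsOf (matching π)) ≤ 27 ×
    independentSets (pairsOf (co (matching π))) ≤ 27 ×
    Vec.sum (pairsOf (matching π)) ≤ 7 × countOf (matching π) 1 0 2 ≤ 27) matchingPermutations
  matching-facts = toWitness {a? = All.all? (λ π → (_ ℕ.≤? 27) ×-dec (_ ℕ.≤? 27) ×-dec (_ ℕ.≤? 7) ×-dec (_ ℕ.≤? 27))
    matchingPermutations} _

  matching-Simple : ∀ π → Simple (matching π)
  matching-Simple π = simple (λ u v → adj-sym 3K₂ (π ⟨$⟩ʳ u) (π ⟨$⟩ʳ v)) (λ u → adj-irrefl 3K₂ (π ⟨$⟩ʳ u))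

  ⟦⟧-injective : ∀ {a b} → ⟦ a ⟧ ≡ ⟦ b ⟧ → a ≡ b
  ⟦⟧-injective {true} {true} _ = refl
  ⟦⟧-injective {false} {false} _ = refl

  tabulate-injective : {A : Set} {g h : Fin n → A} → tabulate g ≡ tabulate h → ∀ i → g i ≡ h i
  tabulate-injective eq zero = proj₁ (∷-injective eq)
  tabulate-injective eq (suc i) = tabulate-injective (proj₂ (∷-injective eq)) i

  pairsOf-injective : {f g : Adjacency n} → Simple f → Simple g → pairsOf f ≡ pairsOf g → f ≐ g
  pairsOf-injective {suc n} {f} {g} sf sg eq = go
    where
    row : ∀ v → f zero (suc v) ≡ g zero (suc v)
    row v = ⟦⟧-injective (tabulate-injective (proj₁ (++-injective
      (tabulate (⟦_⟧ ∘ f zero ∘ suc)) (tabulate (⟦_⟧ ∘ g zero ∘ suc)) eq)) v)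
    go : f ≐ g
    go zero zero = trans (irreflexive sf zero) (sym (irreflexive sg zero))
    go zero (suc v) = row v
    go (suc u) zero = trans (symmetric sf _ _) (trans (row u) (symmetric sg _ _))
    go (suc u) (suc v) = pairsOf-injective
      (simple (λ u v → symmetric sf _ _) (λ u → irreflexive sf _))
      (simple (λ u v → symmetric sg _ _) (λ u → irreflexive sg _))
      (proj₂ (++-injective (tabulate (⟦_⟧ ∘ f zero ∘ suc)) (tabulate (⟦_⟧ ∘ g zero ∘ suc)) eq)) u v

  nbrs-⊥ : (g : Fin n → Bool) → nbrs g ⊥ ≡ 0
  nbrs-⊥ {zero} g = refl
  nbrs-⊥ {suc n} g = nbrs-⊥ (g ∘ suc)

  edges-⊥ : (f : Adjacency n) → edges f ⊥ ≡ 0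
  edges-⊥ {n} f = edges-∅ f ⊥ (∣⊥∣≡0 n)

  nbrs-⁅⁆ : (g : Fin n → Bool) (j : Fin n) → nbrs g ⁅ j ⁆ ≡ ⟦ g j ⟧
  nbrs-⁅⁆ g zero = trans (cong (⟦ g zero ⟧ +_) (nbrs-⊥ (g ∘ suc))) (+-identityʳ _)
  nbrs-⁅⁆ g (suc j) = nbrs-⁅⁆ (g ∘ suc) j

  edges-⁅⁆ : (f : Adjacency n) (j : Fin n) → edges f ⁅ j ⁆ ≡ 0
  edges-⁅⁆ f zero = cong₂ _+_ (nbrs-⊥ (f zero ∘ suc)) (edges-⊥ (below f))
  edges-⁅⁆ f (suc j) = edges-⁅⁆ (below f) j

  -- The value on the diagonal is `⊥`, which lets `edges-pair` hold without assuming `j` and `l`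
  -- distinct.
  pair : Fin n → Fin n → Subset n
  pair zero zero = ⊥
  pair zero (suc l) = true ∷ ⁅ l ⁆
  pair (suc j) zero = true ∷ ⁅ j ⁆
  pair (suc j) (suc l) = false ∷ pair j l

  ∣pair∣ : {j l : Fin n} → j ≢ l → ∣ pair j l ∣ ≡ 2
  ∣pair∣ {j = zero} {zero} j≢l = ⊥-elim (j≢l refl)
  ∣pair∣ {j = zero} {suc l} j≢l = cong suc (∣⁅x⁆∣≡1 l)
  ∣pair∣ {j = suc j} {zero} j≢l = cong suc (∣⁅x⁆∣≡1 j)
  ∣pair∣ {j = suc j} {suc l} j≢l = ∣pair∣ (j≢l ∘ cong suc)

  edges-pair : {f : Adjacency n} → Simple f → ∀ j l → edges f (pair j l) ≡ ⟦ f j l ⟧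
  edges-pair {f = f} sf zero zero = trans (edges-⊥ f) (cong ⟦_⟧ (sym (irreflexive sf zero)))
  edges-pair {f = f} sf zero (suc l) = trans (cong₂ _+_ (nbrs-⁅⁆ (f zero ∘ suc) l) (edges-⁅⁆ (below f) l)) (+-identityʳ _)
  edges-pair {f = f} sf (suc j) zero = trans (cong₂ _+_ (nbrs-⁅⁆ (f zero ∘ suc) j) (edges-⁅⁆ (below f) j))
    (trans (+-identityʳ _) (cong ⟦_⟧ (symmetric sf zero (suc j))))
  edges-pair {f = f} sf (suc j) (suc l) = edges-pair (simple (λ u v → symmetric sf _ _) (λ u → irreflexive sf _)) j l

  zeros-nil : (xs : Vec ℕ n) → zeros xs ≡ true → ∀ i → lookup xs i ≡ 0
  zeros-nil (zero ∷ xs) eq zero = refl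
  zeros-nil (zero ∷ xs) eq (suc i) = zeros-nil xs eq i

  record Extremal (f : Adjacency (6 + k)) : Set where
    constructor extremal
    field
      {perm} : Permutation′ 6
      window : left 6 f ≐ matching perm
      outer : ∀ j u → f (6 ↑ʳ j) u ≡ false

  module _ {f : Adjacency (6 + k)} (sf : Simple f) (tight : ∀ B → count f B ≡ cap ∣ B ∣)
           {π : Permutation′ 6} (π∈ : π ∈ matchingPermutations) (window : left 6 f ≐ matching π) where

    private
      π-facts = All.lookup matching-facts π∈

      vec : pairsOf (left 6 f) ≡ pairsOf (matching π)
      vec = pairsOf-cong window
        where
        pairsOf-cong : ∀ {n} {f g : Adjacency n} → f ≐ g → pairsOf f ≡ pairsOf g
        pairsOf-cong {zero} eq = refl
        pairsOf-cong {suc n} eq = cong₂ _++_ (tabulate-cong (λ v → cong ⟦_⟧ (eq zero (suc v))))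
          (pairsOf-cong (λ u v → eq (suc u) (suc v)))

      is-good : Good f
      is-good = good
        (≤-trans (≤-reflexive (trans (indep-cong window) (sym (independentSets-indep (matching π))))) (proj₁ π-facts))
        (≤-trans (≤-reflexive (trans (indep-cong (co-cong window)) (sym (independentSets-indep (co (matching π))))))
          (proj₁ (proj₂ π-facts)))

    -- Equality for a singleton means 33, above the cap of `check₁`, so `leaf₁` must hold. A perfect
    -- matching has too few edges for its last alternative, and what is left is the absence of edges
    -- to the window.
    tight-cross : ∀ j → zeros (cross 6 f ⁅ j ⁆) ≡ true
    tight-cross j = [ (λ le → ⊥-elim (<-irrefl (trans (tight B) (cong cap (∣⁅x⁆∣≡1 j))) (s≤s le))) ,
      (λ leaf → decide (proj₂ (leaf₁-sound (assignment f B) (count f B)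
        (admissible-assignment sf (inj₁ is-good) B) leaf))) ]′ (bound₁ f B (∣⁅x⁆∣≡1 j))
      where
      B = ⁅ j ⁆
      decide : zeros (Vec.take 6 (Vec.map proj₁ (assignment f B))) ≡ true ⊎
               8 ≤ Vec.sum (Vec.drop 6 (Vec.map proj₁ (assignment f B))) → zeros (cross 6 f B) ≡ true
      decide (inj₁ z) = subst (λ v → zeros (Vec.take 6 v) ≡ true) (map-proj₁-zip (values 6 f B) (values 6 (co f) B)) z
      decide (inj₂ le) = ⊥-elim (≤⇒≯ (proj₁ (proj₂ (proj₂ π-facts))) (subst (λ h → 8 ≤ Vec.sum h) vec
        (subst (λ v → 8 ≤ Vec.sum (Vec.drop 6 v)) (map-proj₁-zip (values 6 f B) (values 6 (co f) B)) le)))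

    tight-apart : Apart f
    tight-apart = apart λ i j → ⟦⟧-injective (trans (sym (nbrs-⁅⁆ _ j))
      (trans (sym (lookup-cross i ⁅ j ⁆)) (zeros-nil (cross 6 f ⁅ j ⁆) (tight-cross j) i)))
      where
      lookup-cross : ∀ i B → lookup (cross 6 f B) i ≡ nbrs (f (i ↑ˡ k) ∘ (6 ↑ʳ_)) B
      lookup-cross 0F B = refl
      lookup-cross 1F B = refl
      lookup-cross 2F B = refl
      lookup-cross 3F B = refl
      lookup-cross 4F B = refl
      lookup-cross 5F B = refl

    -- For a non-adjacent B of two vertices apart from the window, B itself is the one extra set,
    -- being a single non-edge. Adjacency destroys it and leaves only the 27 independent sets of the
    -- window.
    tight-outside : ∀ j l → f (6 ↑ʳ j) (6 ↑ʳ l) ≡ false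
    tight-outside j l with f (6 ↑ʳ j) (6 ↑ʳ l) in adjacent
    ... | false = refl
    ... | true = ⊥-elim (<-irrefl (trans (sym (trans (count-apart f tight-apart window (pair j l)) edge))
                  (trans (tight (pair j l)) (cong cap size))) (s≤s (proj₂ (proj₂ (proj₂ π-facts)))))
      where
      j≢l : j ≢ l
      j≢l refl with () ← trans (sym adjacent) (irreflexive sf (6 ↑ʳ j))
      size : ∣ pair j l ∣ ≡ 2
      size = ∣pair∣ j≢l
      one-edge : edges (right 6 f) (pair j l) ≡ 1
      one-edge = trans (edges-pair (simple (λ u v → symmetric sf _ _) (λ u → irreflexive sf _)) j l) (cong ⟦_⟧ adjacent)
      no-others : edges (right 6 (co f)) (pair j l) ≡ 0
      no-others = suc-injective (trans (cong (_+ edges (right 6 (co f)) (pair j l)) (sym one-edge))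
        (trans (right-co-edges f (pair j l)) (cong tri size)))
      edge : countOf (matching π) (edges (right 6 f) (pair j l)) (edges (right 6 (co f)) (pair j l)) ∣ pair j l ∣ ≡
             countOf (matching π) 1 0 2
      edge rewrite one-edge | no-others | size = refl

    tight-extremal : Extremal f
    tight-extremal = extremal {perm = π} window outer
      where
      outer : ∀ j u → f (6 ↑ʳ j) u ≡ false
      outer j 0F = trans (symmetric sf _ _) (no-cross tight-apart 0F j)
      outer j 1F = trans (symmetric sf _ _) (no-cross tight-apart 1F j)
      outer j 2F = trans (symmetric sf _ _) (no-cross tight-apart 2F j)
      outer j 3F = trans (symmetric sf _ _) (no-cross tight-apart 3F j)
      outer j 4F = trans (symmetric sf _ _) (no-cross tight-apart 4F j)
      outer j 5F = trans (symmetric sf _ _) (no-cross tight-apart 5F j)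
      outer j (suc (suc (suc (suc (suc (suc l)))))) = tight-outside j l

  does-true : {P : Set} (P? : Dec P) → does P? ≡ true → P
  does-true (yes p) _ = p

  matchingVec-sound : ∀ {g} → matchingVec g ≡ true → {h : Adjacency 6} → Simple h → g ≡ pairsOf h →
    ∃[ π ] (π ∈ matchingPermutations × h ≐ matching π)
  matchingVec-sound {g} eq sh refl =
    let π , π∈ , same = find (does-true (Any.any? (λ π → ≡-dec ℕ._≟_ g (pairsOf (matching π))) matchingPermutations) eq)
    in π , π∈ , pairsOf-injective sh (matching-Simple π) same

  -- Equality for B = ∅ means 39, above the cap of `check₀`, so `leaf₀` finds a perfect matching in
  -- the window of the graph or of its complement. The counts agree for both, so one argument serves
  -- the two cases.
  tight-cases : {f : Adjacency (6 + k)} → Simple f → (∀ B → count f B ≡ cap ∣ B ∣) → Extremal f ⊎ Extremal (co f)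
  tight-cases {k} {f} sf tight =
    [ (λ le → ⊥-elim (<-irrefl (trans (tight ⊥) (cong cap (∣⊥∣≡0 k))) (s≤s le))) ,
      (λ leaf → decide (proj₂ (leaf₀-sound (assignment f ⊥) (count f ⊥) leaf))) ]′ (bound₀ f ⊥ (∣⊥∣≡0 k))
    where
    decide : matchingVec (Vec.drop 6 (Vec.map proj₁ (assignment f ⊥))) ≡ true ⊎
             matchingVec (Vec.drop 6 (Vec.map proj₂ (assignment f ⊥))) ≡ true → Extremal f ⊎ Extremal (co f)
    decide (inj₁ eq) = inj₁ (tight-extremal sf tight (proj₁ (proj₂ found)) (proj₂ (proj₂ found)))
      where
      found = matchingVec-sound eq (left-Simple 6 sf)
        (cong (Vec.drop 6) (map-proj₁-zip (values 6 f ⊥) (values 6 (co f) ⊥)))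
    decide (inj₂ eq) = inj₂ (tight-extremal (co-Simple sf) (λ B → trans (count-co sf B) (tight B))
          (proj₁ (proj₂ found)) (proj₂ (proj₂ found)))
      where
      found = matchingVec-sound eq (left-Simple 6 (co-Simple sf))
        (cong (Vec.drop 6) (map-proj₂-zip (values 6 f ⊥) (values 6 (co f) ⊥)))

-- Existence of a suitable window

module WindowExistence where

  open import Defs hiding (_∨_; _∪_)
  open Counting
  open BranchAndBound
  open WindowChecks
  open WindowBounds
  open UpperBound
  open import Data.Bool.Base using (Bool; true; false; not; _∧_; _∨_)
  open import Data.Bool.ListAction using (all)
  import Data.Bool.Properties as Bool
  open import Data.Empty using (⊥-elim)
  open import Data.Fin.Base using (Fin; zero; suc; _↑ˡ_; _↑ʳ_; splitAt; inject≤)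
  open import Data.Fin.Patterns
  open import Data.Fin.Permutation as Perm using (Permutation′; _⟨$⟩ʳ_; _⟨$⟩ˡ_; _∘ₚ_; transpose)
  open import Data.Fin.Permutation.Transposition.List using (TranspositionList; eval; decompose; eval-decompose)
  open import Data.Fin.Properties using (_≟_; all?; any?; ↑ˡ-injective; inject≤-injective; join-splitAt)
  open import Data.Fin.Subset using (Subset; ∁; ⁅_⁆; ∣_∣)
  open import Data.List.Base using (List; []; _∷_; allFin)
  open import Data.List.Membership.Propositional using (_∈_)
  open import Data.List.Membership.Propositional.Properties using (∈-allFin)
  open import Data.List.Relation.Unary.Any using (here; there)
  open import Data.Nat.Base
  open import Data.Nat.Properties hiding (_<?_; _≟_)
  open import Data.Product.Base using (_×_; _,_; proj₁; proj₂; ∃-syntax)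
  open import Data.Sum.Base using (_⊎_; inj₁; inj₂; [_,_]′)
  open import Data.Vec.Base as Vec using (Vec; lookup; zip)
  open import Data.Vec.Functional using () renaming ([] to ε; _∷_ to _◂_)
  open import Data.Vec.Properties using (map-proj₁-zip)
  open import Function.Base using (_∘_; id)
  open import Relation.Binary.PropositionalEquality
  open import Relation.Nullary.Decidable using (Dec; yes; no; dec-true; dec-false; _×-dec_; ¬?)
  open import Relation.Nullary.Negation using (¬_)

  private variable
    k m n : ℕ

  nbrs-local : {g h : Fin n → Bool} (S : Subset n) → (∀ v → lookup S v ≡ true → g v ≡ h v) → nbrs g S ≡ nbrs h S
  nbrs-local Vec.[] eq = refl
  nbrs-local (true Vec.∷ S) eq = cong₂ (λ b x → ⟦ b ⟧ + x) (eq zero refl) (nbrs-local S (eq ∘ suc))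
  nbrs-local (false Vec.∷ S) eq = nbrs-local S (eq ∘ suc)

  edges-local : {f g : Adjacency n} (S : Subset n) →
    (∀ u v → lookup S u ≡ true → lookup S v ≡ true → f u v ≡ g u v) → edges f S ≡ edges g S
  edges-local Vec.[] eq = refl
  edges-local (true Vec.∷ S) eq = cong₂ _+_ (nbrs-local S (λ v → eq zero (suc v) refl)) (edges-local S (λ u v → eq (suc u) (suc v)))
  edges-local (false Vec.∷ S) eq = edges-local S (λ u v → eq (suc u) (suc v))

  AgreeOff : Fin n → Adjacency n → Adjacency n → Set
  AgreeOff a f g = ∀ u v → u ≢ a → v ≢ a → f u v ≡ g u v

  edges-agree : {f g : Adjacency 6} (a : Fin 6) → AgreeOff a f g → edges f (∁ ⁅ a ⁆) ≡ edges g (∁ ⁅ a ⁆)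
  edges-agree a agree = edges-local (∁ ⁅ a ⁆) (λ u v u∈ v∈ → agree u v (off a u∈) (off a v∈))
    where
    off : ∀ (a : Fin 6) {u} → lookup (∁ ⁅ a ⁆) u ≡ true → u ≢ a
    off 0F () refl
    off 1F () refl
    off 2F () refl
    off 3F () refl
    off 4F () refl
    off 5F () refl

  all-lookup : {A : Set} (p : A → Bool) (xs : List A) → all p xs ≡ true → ∀ {x} → x ∈ xs → p x ≡ true
  all-lookup p (x ∷ xs) eq (here refl) = proj₁ (∧-true eq)
  all-lookup p (x ∷ xs) eq (there x∈) = all-lookup p xs (proj₂ (∧-true {p x} eq)) x∈

  -- Two necessary conditions for having more than 27 independent sets, with separate uses: the
  -- first is violated by the configurations in `pattern-window`, the second yields
  -- `exchange-vertex`.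
  FewEdges : Adjacency 6 → Set
  FewEdges h = twoAttached (pairsOf h) ≡ false × (∀ a → edges h (∁ ⁅ a ⁆) ≤ 4)

  not-true : ∀ {b} → not b ≡ true → b ≡ false
  not-true {false} _ = refl

  leafᵢ-sound : (h : Adjacency 6) → ∀ ρ t → Vec.map proj₁ ρ ≡ pairsOf h → leafᵢ ρ t ≡ true → FewEdges h
  leafᵢ-sound h ρ t p eq =
    subst (λ v → twoAttached v ≡ false) p (not-true (proj₁ (∧-true eq))) ,
    λ a → subst (_≤ 4) (trans (cong (dot (pairs (∁ ⁅ a ⁆))) p) (edges-dot h (∁ ⁅ a ⁆))) (≤ᵇ-true⇒≤ (at a))
    where
    at : ∀ a → (dot (pairs (∁ ⁅ a ⁆)) (Vec.map proj₁ ρ) ≤ᵇ 4) ≡ true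
    at a = all-lookup (λ a → dot (pairs (∁ ⁅ a ⁆)) (Vec.map proj₁ ρ) ≤ᵇ 4) (allFin 6)
      (proj₂ (∧-true {not (twoAttached (Vec.map proj₁ ρ))} eq)) (∈-allFin a)

  few-independent-or-edges : (h : Adjacency 6) → indep h ≤ 27 ⊎ FewEdges h
  few-independent-or-edges h = [ inj₁ , (λ leaf → inj₂ (leafᵢ-sound h ρ (indep h)
      (map-proj₁-zip (pairsOf h) (pairsOf (co h))) leaf)) ]′
    (search-sound 27 leafᵢ (Vec.replicate 15 bit) (testSets 1 2 pairs) checkᵢ (pairs-valid h) eq)
    where
    ρ = zip (pairsOf h) (pairsOf (co h))
    one-free : ∀ a b → free a ≡ one (suc a) (suc (suc b))
    one-free 0 b = refl
    one-free (suc a) b = refl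
    eq : indep h ≡ total (testSets 1 2 pairs) ρ
    eq = trans (∑ₛ-cong (λ A → trans (cong free (trans (sym (edges-dot h A))
        (cong (dot (pairs A)) (sym (map-proj₁-zip (pairsOf h) (pairsOf (co h)))))))
        (one-free _ (dot (pairs A) (Vec.map proj₂ ρ)))))
      (sym (total-testSets 1 2 pairs ρ))

  -- A window that is too dense does not become too sparse by replacing one vertex:
  -- the other five vertices span 10 pairs, at most 4 of them non-adjacent.
  exchange-vertex : {h h′ : Adjacency 6} (a : Fin 6) → AgreeOff a h h′ → 28 ≤ indep (co h) → indep h′ ≤ 27
  exchange-vertex {h} {h′} a agree dense =
    [ (λ le → ⊥-elim (<⇒≱ dense le)) , (λ few → [ id , (λ few′ → ⊥-elim (clash few few′)) ]′ (few-independent-or-edges h′)) ]′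
    (few-independent-or-edges (co h))
    where
    S = ∁ ⁅ a ⁆
    size : ∀ a → tri ∣ ∁ {6} ⁅ a ⁆ ∣ ≡ 10
    size 0F = refl
    size 1F = refl
    size 2F = refl
    size 3F = refl
    size 4F = refl
    size 5F = refl
    clash : FewEdges (co h) → ¬ FewEdges h′
    clash (_ , few) (_ , few′) = <⇒≱ (+-mono-≤-< (≤-trans (≤-reflexive (edges-agree a agree)) (few′ a)) (s≤s (few a)))
      (≤-trans (m≤n+m 9 1) (≤-reflexive (sym (trans (edges-co h S) (size a)))))

  pull : Permutation′ n → Adjacency n → Adjacency n
  pull π f u v = f (π ⟨$⟩ʳ u) (π ⟨$⟩ʳ v)

  permutation-injective : (π : Permutation′ n) → ∀ {u v} → π ⟨$⟩ʳ u ≡ π ⟨$⟩ʳ v → u ≡ v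
  permutation-injective π eq = trans (sym (Perm.inverseˡ π)) (trans (cong (π ⟨$⟩ˡ_) eq) (Perm.inverseˡ π))

  pull-Simple : (π : Permutation′ n) {f : Adjacency n} → Simple f → Simple (pull π f)
  pull-Simple π sf = simple (λ u v → symmetric sf _ _) (λ u → irreflexive sf _)

  pull-co : (π : Permutation′ n) (f : Adjacency n) → pull π (co f) ≐ co (pull π f)
  pull-co π f u v = cong (_∧ not (pull π f u v)) (distinct-injective (π ⟨$⟩ʳ_) (permutation-injective π) u v)

  transpose-first : (i j : Fin n) → transpose i j ⟨$⟩ʳ i ≡ j
  transpose-first i j rewrite dec-true (i ≟ i) refl = refl

  transpose-second : (i j : Fin n) → transpose i j ⟨$⟩ʳ j ≡ i
  transpose-second i j with j ≟ i
  ... | yes j≡i = j≡i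
  ... | no _ rewrite dec-true (j ≟ j) refl = refl

  transpose-other : {i j u : Fin n} → u ≢ i → u ≢ j → transpose i j ⟨$⟩ʳ u ≡ u
  transpose-other {i = i} {j} {u} u≢i u≢j rewrite dec-false (u ≟ i) u≢i | dec-false (u ≟ j) u≢j = refl

  ↑ˡ≢↑ʳ : ∀ {m k} (i : Fin m) (j : Fin k) → i ↑ˡ k ≢ m ↑ʳ j
  ↑ˡ≢↑ʳ zero j ()
  ↑ˡ≢↑ʳ (suc i) j eq = ↑ˡ≢↑ʳ i j (Data.Fin.Properties.suc-injective eq)

  transpose-↑ˡ : ∀ k (a b u : Fin m) → transpose (a ↑ˡ k) (b ↑ˡ k) ⟨$⟩ʳ (u ↑ˡ k) ≡ (transpose a b ⟨$⟩ʳ u) ↑ˡ k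
  transpose-↑ˡ k a b u with u ≟ a
  ... | yes refl = transpose-first (u ↑ˡ k) (b ↑ˡ k)
  ... | no u≢a with u ≟ b
  ...   | yes refl = transpose-second (a ↑ˡ k) (u ↑ˡ k)
  ...   | no u≢b = transpose-other (u≢a ∘ ↑ˡ-injective k u a) (u≢b ∘ ↑ˡ-injective k u b)

  data Side {m k} : Fin (m + k) → Set where
    inside : (a : Fin m) → Side (a ↑ˡ k)
    outside : (b : Fin k) → Side (m ↑ʳ b)

  side : ∀ m {k} (i : Fin (m + k)) → Side {m} i
  side m {k} i with splitAt m i in eq
  ... | inj₁ a = subst Side (trans (cong (Data.Fin.Base.join m k) (sym eq)) (join-splitAt m k i)) (inside a)
  ... | inj₂ b = subst Side (trans (cong (Data.Fin.Base.join m k) (sym eq)) (join-splitAt m k i)) (outside b)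

  Dense : Adjacency (6 + k) → Set
  Dense f = 28 ≤ indep (co (left 6 f))

  good-or-dense : (f : Adjacency (6 + k)) → indep (left 6 f) ≤ 27 → Good f ⊎ Dense f
  good-or-dense f i with indep (co (left 6 f)) ≤? 27
  ... | yes c = inj₁ (good i c)
  ... | no c = inj₂ (≰⇒> c)

  -- Swapping two vertices on the same side leaves the vertex set of the window unchanged, so
  -- density persists. A swap across the boundary replaces one window vertex; by `exchange-vertex`
  -- the new window has few independent sets, and it is good unless it is again dense.
  dense-transpose : {f : Adjacency (6 + k)} → Simple f → Dense f → ∀ i j →
    Good (pull (transpose i j) f) ⊎ Dense (pull (transpose i j) f)
  dense-transpose {k} {f} sf dense i j with side 6 i | side 6 j
  ... | inside a | inside b = inj₂ (subst (28 ≤_) (sym (∑ₛ-edges-relabel free (transpose a b)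
      (co-Simple (left-Simple 6 (pull-Simple (transpose (a ↑ˡ k) (b ↑ˡ k)) sf))) (co-Simple (left-Simple 6 sf)) same)) dense)
    where
    same : ∀ u v → co (left 6 (pull (transpose (a ↑ˡ k) (b ↑ˡ k)) f)) u v ≡
      co (left 6 f) (transpose a b ⟨$⟩ʳ u) (transpose a b ⟨$⟩ʳ v)
    same u v = trans
      (cong₂ (λ x y → distinct u v ∧ not (f x y)) (transpose-↑ˡ k a b u) (transpose-↑ˡ k a b v))
      (sym (pull-co (transpose a b) (left 6 f) u v))
  ... | inside a | outside b = good-or-dense _ (exchange-vertex a agree dense)
    where
    agree : AgreeOff a (left 6 f) (left 6 (pull (transpose (a ↑ˡ k) (6 ↑ʳ b)) f))
    agree u v u≢a v≢a = sym (cong₂ f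
      (transpose-other (u≢a ∘ ↑ˡ-injective k u a) (↑ˡ≢↑ʳ u b)) (transpose-other (v≢a ∘ ↑ˡ-injective k v a) (↑ˡ≢↑ʳ v b)))
  ... | outside b | inside a = good-or-dense _ (exchange-vertex a agree dense)
    where
    agree : AgreeOff a (left 6 f) (left 6 (pull (transpose (6 ↑ʳ b) (a ↑ˡ k)) f))
    agree u v u≢a v≢a = sym (cong₂ f
      (transpose-other (↑ˡ≢↑ʳ u b) (u≢a ∘ ↑ˡ-injective k u a)) (transpose-other (↑ˡ≢↑ʳ v b) (v≢a ∘ ↑ˡ-injective k v a)))
  ... | outside a | outside b = inj₂ (subst (28 ≤_) (indep-cong (co-cong λ u v → sym (cong₂ f
      (transpose-other (↑ˡ≢↑ʳ u a) (↑ˡ≢↑ʳ u b)) (transpose-other (↑ˡ≢↑ʳ v a) (↑ˡ≢↑ʳ v b))))) dense)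

  -- A discrete intermediate value argument: along a sequence of swaps a dense window stays dense
  -- unless a good one is met. Density at the end is refuted later by the choice of the target
  -- permutation.
  dense-transpositions : {f : Adjacency (6 + k)} → Simple f → Dense f → (ts : TranspositionList (6 + k)) →
    (∃[ π ] Good (pull π f)) ⊎ Dense (pull (eval ts) f)
  dense-transpositions sf dense [] = inj₂ dense
  dense-transpositions sf dense ((i , j) ∷ ts) with dense-transpositions sf dense ts
  ... | inj₁ found = inj₁ found
  ... | inj₂ dense′ with dense-transpose (pull-Simple (eval ts) sf) dense′ i j
  ...   | inj₁ g = inj₁ (transpose i j ∘ₚ eval ts , g)
  ...   | inj₂ d = inj₂ d

  Inj : (Fin m → Fin n) → Set
  Inj g = ∀ {i j} → g i ≡ g j → i ≡ j

  -- The positions are corrected one at a time by a transposition applied after `π`. It leaves the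
  -- earlier ones alone, since injectivity keeps their images away from both of its entries.
  place : (e g : Fin m → Fin n) → Inj e → Inj g → ∃[ π ] (∀ i → π ⟨$⟩ʳ e i ≡ g i)
  place {zero} e g e-inj g-inj = Perm.id , λ ()
  place {suc m} e g e-inj g-inj = π ∘ₚ t , λ { zero → transpose-first (π ⟨$⟩ʳ e zero) (g zero) ; (suc i) → trans (cong (t ⟨$⟩ʳ_) (fixed i))
      (transpose-other (λ eq → suc≢zero (e-inj (permutation-injective π (trans (fixed i) eq)))) (λ eq → suc≢zero (g-inj eq))) }
    where
    rest = place (e ∘ suc) (g ∘ suc) (Data.Fin.Properties.suc-injective ∘ e-inj) (Data.Fin.Properties.suc-injective ∘ g-inj)
    π = proj₁ rest
    fixed = proj₂ rest
    t = transpose (π ⟨$⟩ʳ e zero) (g zero)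
    suc≢zero : ∀ {i : Fin m} → suc i ≢ zero
    suc≢zero ()

  -- Six vertices with few independent sets, or a sparse graph

  Selected : Adjacency (6 + k) → Set
  Selected f = ∃[ π ] (indep (left 6 (pull π f)) ≤ 27 ⊎ Sparse (pull π f))

  Outside : (Fin m → Fin n) → Fin n → Set
  Outside g w = ∀ i → g i ≢ w

  outside? : (g : Fin m → Fin n) → ∀ w → Dec (Outside g w)
  outside? g w = all? (λ i → ¬? (g i ≟ w))

  Inj-∷ : {g : Fin m → Fin n} {x : Fin n} → Inj g → Outside g x → Inj (x ◂ g)
  Inj-∷ inj out {zero} {zero} eq = refl
  Inj-∷ inj out {zero} {suc j} eq = ⊥-elim (out j (sym eq))
  Inj-∷ inj out {suc i} {zero} eq = ⊥-elim (out i eq)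
  Inj-∷ inj out {suc i} {suc j} eq = cong suc (inj eq)

  Outside-∷ : {g : Fin m → Fin n} {x w : Fin n} → x ≢ w → Outside g w → Outside (x ◂ g) w
  Outside-∷ x≢w out zero = x≢w
  Outside-∷ x≢w out (suc i) = out i

  Inj-[] : Inj {zero} {n} ε
  Inj-[] {_} {()}

  outside-or-at : (g : Fin m → Fin n) (w : Fin n) → Outside g w ⊎ ∃[ i ] (g i ≡ w)
  outside-or-at g w with any? (λ i → g i ≟ w)
  ... | yes found = inj₂ found
  ... | no none = inj₁ (λ i eq → none (i , eq))

  ¬true : ∀ {b} → b ≢ true → b ≡ false
  ¬true {true} ne = ⊥-elim (ne refl)
  ¬true {false} ne = refl

  -- The listed vertices may be fewer than six: they are placed at the front of the window, the rest
  -- is filled arbitrarily, and every vertex left outside is isolated.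
  cover : (f : Adjacency (6 + k)) (g : Fin m → Fin (6 + k)) → Inj g → m ≤ 6 →
    (∀ w → Outside g w → ∀ t → f w t ≢ true) → Selected f
  cover {k} f g inj m≤6 covered = π , inj₂ (isolated λ j u → ¬true (covered _ (out j) _))
    where
    e : Fin _ → Fin (6 + k)
    e i = inject≤ i m≤6 ↑ˡ k
    placed = place e g (λ eq → inject≤-injective m≤6 m≤6 _ _ (↑ˡ-injective k _ _ eq)) inj
    π = proj₁ placed
    out : ∀ j → Outside g (π ⟨$⟩ʳ (6 ↑ʳ j))
    out j i eq = ↑ˡ≢↑ʳ (inject≤ i m≤6) j (permutation-injective π (trans (proj₂ placed i) eq))

  attach-sum : (b : Fin 4 → Bool) (i : Fin 4) → b i ≡ true →
    (1 ≤ᵇ ⟦ b 0F ⟧ + (⟦ b 1F ⟧ + (⟦ b 2F ⟧ + ⟦ b 3F ⟧))) ≡ true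
  attach-sum b i eq = ≤⇒≤ᵇ-true (go i eq)
    where
    at : ∀ {c} → c ≡ true → 1 ≤ ⟦ c ⟧
    at refl = s≤s z≤n
    go : ∀ i → b i ≡ true → 1 ≤ ⟦ b 0F ⟧ + (⟦ b 1F ⟧ + (⟦ b 2F ⟧ + ⟦ b 3F ⟧))
    go 0F eq = m≤n⇒m≤n+o _ (at eq)
    go 1F eq = m≤n⇒m≤o+n ⟦ b 0F ⟧ (m≤n⇒m≤n+o _ (at eq))
    go 2F eq = m≤n⇒m≤o+n ⟦ b 0F ⟧ (m≤n⇒m≤o+n ⟦ b 1F ⟧ (m≤n⇒m≤n+o _ (at eq)))
    go 3F eq = m≤n⇒m≤o+n ⟦ b 0F ⟧ (m≤n⇒m≤o+n ⟦ b 1F ⟧ (m≤n⇒m≤o+n ⟦ b 2F ⟧ (at eq)))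

  module _ {f : Adjacency (6 + k)} (sf : Simple f) where

    private
      V = Fin (6 + k)

    flip-edge : ∀ {u v} → f u v ≡ true → f v u ≡ true
    flip-edge {u} {v} eq = trans (symmetric sf v u) eq

    edge-≢ : ∀ {u v} → f u v ≡ true → u ≢ v
    edge-≢ {u} eq refl with () ← trans (sym eq) (irreflexive sf u)

    attached : V → (Fin 4 → V) → Set
    attached w g = ∃[ i ] f w (g i) ≡ true

    -- Both configurations contain 3K₂, P₃ ∪ P₃ or K₁,₃ ∪ K₂.
    pattern-window : (q p : V) (core : Fin 4 → V) → Inj (q ◂ p ◂ core) →
      f (core 0F) (core 1F) ≡ true → f (core 2F) (core 3F) ≡ true →
      f q p ≡ true ⊎ attached q core × attached p core → Selected f
    pattern-window q p core inj e₁ e₂ e₃ = π , inj₁ (≤-trans (≤-reflexive (indep-cong same))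
        ([ id , (λ few → ⊥-elim (clash (proj₁ few))) ]′ (few-independent-or-edges h)))
      where
      g = q ◂ p ◂ core
      h : Adjacency 6
      h u v = f (g u) (g v)
      placed = place (_↑ˡ k) g (↑ˡ-injective k _ _) inj
      π = proj₁ placed
      same : left 6 (pull π f) ≐ h
      same u v = cong₂ f (proj₂ placed u) (proj₂ placed v)
      extra-edges : f q p ≡ true ⊎ attached q core × attached p core →
        (1 ≤ᵇ ⟦ f q p ⟧) ∨ ((1 ≤ᵇ ⟦ f q (core 0F) ⟧ + (⟦ f q (core 1F) ⟧ + (⟦ f q (core 2F) ⟧ + ⟦ f q (core 3F) ⟧))) ∧
          (1 ≤ᵇ ⟦ f p (core 0F) ⟧ + (⟦ f p (core 1F) ⟧ + (⟦ f p (core 2F) ⟧ + ⟦ f p (core 3F) ⟧)))) ≡ true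
      extra-edges (inj₁ qp) rewrite qp = refl
      extra-edges (inj₂ ((i , qi) , (j , pj))) = ∨-trueʳ (1 ≤ᵇ ⟦ f q p ⟧)
        (cong₂ _∧_ (attach-sum (λ i → f q (core i)) i qi) (attach-sum (λ i → f p (core i)) j pj))
      two : twoAttached (pairsOf h) ≡ true
      two = cong₂ _∧_ {v = true} (cong (λ b → 1 ≤ᵇ ⟦ b ⟧) e₁) (cong₂ _∧_ {v = true} (cong (λ b → 1 ≤ᵇ ⟦ b ⟧) e₂) (extra-edges e₃))
      clash : twoAttached (pairsOf h) ≢ false
      clash eq with () ← trans (sym two) eq

    DisjointEdges : V → V → V → V → Set
    DisjointEdges u v x y = f u v ≡ true × f x y ≡ true × x ≢ u × x ≢ v × y ≢ u × y ≢ v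

    disjointEdges? : ∀ u v x y → Dec (DisjointEdges u v x y)
    disjointEdges? u v x y = f u v Bool.≟ true ×-dec f x y Bool.≟ true ×-dec
      ¬? (x ≟ u) ×-dec ¬? (x ≟ v) ×-dec ¬? (y ≟ u) ×-dec ¬? (y ≟ v)

    -- The ends of the two edges form a core. An edge avoiding the core, or two further vertices
    -- attached to it, completes a window with few independent sets. If neither exists, at most one
    -- vertex outside the core has any neighbour, so all edges lie within five vertices.
    from-disjoint : ∀ {u v x y} → DisjointEdges u v x y → Selected f
    from-disjoint {u} {v} {x} {y} (uv , xy , x≢u , x≢v , y≢u , y≢v) = third-edge
      where
      core : Fin 4 → V
      core = y ◂ x ◂ v ◂ u ◂ ε
      core-inj : Inj core
      core-inj = Inj-∷ (Inj-∷ (Inj-∷ (Inj-∷ Inj-[] (λ ())) (Outside-∷ (edge-≢ uv) (λ ())))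
        (Outside-∷ (x≢v ∘ sym) (Outside-∷ (x≢u ∘ sym) (λ ()))))
        (Outside-∷ (edge-≢ xy) (Outside-∷ (y≢v ∘ sym) (Outside-∷ (y≢u ∘ sym) (λ ()))))
      attached? : ∀ w → Dec (attached w core)
      attached? w = any? (λ i → f w (core i) Bool.≟ true)
      window : ∀ {q p} → Outside core q → Outside core p → q ≢ p →
        f q p ≡ true ⊎ attached q core × attached p core → Selected f
      window q-out p-out q≢p = pattern-window _ _ core (Inj-∷ (Inj-∷ core-inj p-out) (Outside-∷ (q≢p ∘ sym) q-out))
        (flip-edge xy) (flip-edge uv)
      ThirdEdge TwoAttached OneAttached : Set
      ThirdEdge = ∃[ q ] ∃[ p ] (Outside core q × Outside core p × f q p ≡ true)
      TwoAttached = ∃[ q ] ∃[ p ] (Outside core q × Outside core p × q ≢ p × attached q core × attached p core)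
      OneAttached = ∃[ p ] (Outside core p × attached p core)
      by-one : ¬ ThirdEdge → ¬ TwoAttached → Dec OneAttached → Selected f
      by-one no-third no-two (yes (p , p-out , ap)) =
        cover f (p ◂ core) (Inj-∷ core-inj p-out) (s≤s (s≤s (s≤s (s≤s (s≤s z≤n))))) covered
        where
        covered : ∀ w → Outside (p ◂ core) w → ∀ t → f w t ≢ true
        covered w out t wt with outside-or-at core t
        ... | inj₁ t-out = no-third (w , t , out ∘ suc , t-out , wt)
        ... | inj₂ (i , refl) = no-two (p , w , p-out , out ∘ suc , out zero , ap , (i , wt))
      by-one no-third no-two (no no-one) = cover f core core-inj (s≤s (s≤s (s≤s (s≤s z≤n)))) covered
        where
        covered : ∀ w → Outside core w → ∀ t → f w t ≢ true
        covered w out t wt with outside-or-at core t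
        ... | inj₁ t-out = no-third (w , t , out , t-out , wt)
        ... | inj₂ (i , refl) = no-one (w , out , (i , wt))
      by-two : ¬ ThirdEdge → Dec TwoAttached → Selected f
      by-two no-third (yes (q , p , q-out , p-out , q≢p , aq , ap)) = window q-out p-out q≢p (inj₂ (aq , ap))
      by-two no-third (no no-two) = by-one no-third no-two (any? (λ p → outside? core p ×-dec attached? p))
      by-third : Dec ThirdEdge → Selected f
      by-third (yes (q , p , q-out , p-out , qp)) = window q-out p-out (edge-≢ qp) (inj₁ qp)
      by-third (no no-third) = by-two no-third (any? (λ q → any? (λ p →
        outside? core q ×-dec outside? core p ×-dec ¬? (q ≟ p) ×-dec attached? q ×-dec attached? p)))
      third-edge : Selected f
      third-edge = by-third (any? (λ q → any? (λ p →
        outside? core q ×-dec outside? core p ×-dec f q p Bool.≟ true)))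

    module _ (z : V) (star-edges : ∀ a b → a ≢ z → b ≢ z → f a b ≢ true) where

      -- `d` leaves are still to be found beside the `m` leaves in `g`. If the supply ends before
      -- five, the centre and its leaves fit into the window and `cover` applies; with five leaves
      -- the window is that of the constructor `star`.
      leaves : ∀ d m → d + m ≡ 5 → (g : Fin m → V) → Inj g → Outside g z → (∀ i → f z (g i) ≡ true) → Selected f
      leaves zero .5 refl g inj out adjacent = π , inj₂ (star
          (λ u v u≢0 v≢0 → ¬true (star-edges _ _ (away u≢0) (away v≢0)))
          (λ i → trans (cong₂ f (proj₂ placed zero) (proj₂ placed (suc i))) (adjacent i)))
        where
        placed = place (_↑ˡ k) (z ◂ g) (↑ˡ-injective k _ _) (Inj-∷ inj out)
        π = proj₁ placed
        away : ∀ {u} → u ≢ 0F → π ⟨$⟩ʳ u ≢ z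
        away u≢0 eq = u≢0 (permutation-injective π (trans eq (sym (proj₂ placed zero))))
      leaves (suc d) m eq g inj out adjacent with any? (λ y → f z y Bool.≟ true ×-dec outside? g y)
      ... | yes (y , zy , y-out) = leaves d (suc m) (trans (+-suc d m) eq) (y ◂ g) (Inj-∷ inj y-out)
          (Outside-∷ (edge-≢ zy ∘ sym) out) (λ { zero → zy ; (suc i) → adjacent i })
      ... | no no-more = cover f (z ◂ g) (Inj-∷ inj out) (s≤s (≤-trans (m≤n+m m (suc d)) (≤-reflexive eq))) covered
        where
        covered : ∀ w → Outside (z ◂ g) w → ∀ t → f w t ≢ true
        covered w w-out t wt with t ≟ z
        ... | yes refl = no-more (w , flip-edge wt , w-out ∘ suc)
        ... | no t≢z = star-edges w t (w-out zero ∘ sym) t≢z wt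

      from-star : Selected f
      from-star = leaves 5 0 refl ε Inj-[] (λ ()) (λ ())

    module _ (no-disjoint : ∀ {u v x y} → ¬ DisjointEdges u v x y) where

      -- Up to isolated vertices, a graph with an edge and no two disjoint edges is a triangle or a
      -- star. Without a triangle on `u` and `v`, a second edge at `v` makes `v` the centre;
      -- otherwise `u` is.
      from-edge : ∀ {u v} → f u v ≡ true → Selected f
      from-edge {u} {v} uv with any? (λ x → f u x Bool.≟ true ×-dec f v x Bool.≟ true)
      ... | yes (x , ux , vx) = cover f (x ◂ v ◂ u ◂ ε) (Inj-∷ (Inj-∷ (Inj-∷ Inj-[] (λ ())) (Outside-∷ (edge-≢ uv) (λ ())))
            (Outside-∷ (edge-≢ vx) (Outside-∷ (edge-≢ ux) (λ ())))) (s≤s (s≤s (s≤s z≤n))) covered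
        where
        covered : ∀ w → Outside (x ◂ v ◂ u ◂ ε) w → ∀ t → f w t ≢ true
        covered w out t wt with t ≟ u | t ≟ v
        ... | yes refl | _ = no-disjoint (wt , vx , out 1F , edge-≢ uv ∘ sym , out 0F , edge-≢ ux ∘ sym)
        ... | no _ | yes refl = no-disjoint (wt , ux , out 2F , edge-≢ uv , out 0F , edge-≢ vx ∘ sym)
        ... | no t≢u | no t≢v = no-disjoint (wt , uv , out 2F , t≢u ∘ sym , out 1F , t≢v ∘ sym)
      ... | no no-triangle with any? (λ y → ¬? (y ≟ u) ×-dec f v y Bool.≟ true)
      ...   | yes (y , y≢u , vy) = from-star v at-v
        where
        at-u : ∀ b → b ≢ v → f u b ≢ true
        at-u b b≢v ub with b ≟ y
        ... | yes refl = no-triangle (b , ub , vy)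
        ... | no b≢y = no-disjoint (ub , vy , edge-≢ uv ∘ sym , b≢v ∘ sym , y≢u , b≢y ∘ sym)
        at-v : ∀ a b → a ≢ v → b ≢ v → f a b ≢ true
        at-v a b a≢v b≢v ab with a ≟ u | b ≟ u
        ... | yes refl | _ = at-u b b≢v ab
        ... | no _ | yes refl = at-u a a≢v (flip-edge ab)
        ... | no a≢u | no b≢u = no-disjoint (ab , uv , a≢u ∘ sym , b≢u ∘ sym , a≢v ∘ sym , b≢v ∘ sym)
      ...   | no only-u = from-star u at-u
        where
        at-u : ∀ a b → a ≢ u → b ≢ u → f a b ≢ true
        at-u a b a≢u b≢u ab with a ≟ v | b ≟ v
        ... | yes refl | _ = only-u (b , b≢u , ab)
        ... | no _ | yes refl = only-u (a , a≢u , flip-edge ab)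
        ... | no a≢v | no b≢v = no-disjoint (ab , uv , a≢u ∘ sym , b≢u ∘ sym , a≢v ∘ sym , b≢v ∘ sym)

    select : Selected f
    select = by-disjoint (any? (λ u → any? (λ v → any? (λ x → any? (λ y → disjointEdges? u v x y)))))
      where
      by-edge : (∀ {u v x y} → ¬ DisjointEdges u v x y) → Dec (∃[ u ] ∃[ v ] f u v ≡ true) → Selected f
      by-edge no-disjoint (yes (_ , _ , uv)) = from-edge no-disjoint uv
      by-edge no-disjoint (no no-edge) = cover f ε Inj-[] z≤n (λ w _ t wt → no-edge (w , t , wt))
      by-disjoint : Dec (∃[ u ] ∃[ v ] ∃[ x ] ∃[ y ] DisjointEdges u v x y) → Selected f
      by-disjoint (yes (_ , _ , _ , _ , disjoint)) = from-disjoint disjoint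
      by-disjoint (no no-disjoint) = by-edge (λ {u} {v} {x} {y} d → no-disjoint (u , v , x , y , d))
        (any? (λ u → any? (λ v → f u v Bool.≟ true)))

  Sparse-cong : {f g : Adjacency (6 + k)} → f ≐ g → Sparse f → Sparse g
  Sparse-cong eq (isolated iso) = isolated λ j u → trans (sym (eq _ _)) (iso j u)
  Sparse-cong eq (star off on) = star (λ u v u≢0 v≢0 → trans (sym (eq _ _)) (off u v u≢0 v≢0)) (λ i → trans (sym (eq _ _)) (on i))

  left-cong : {f g : Adjacency (m + k)} → f ≐ g → left m f ≐ left m g
  left-cong eq u v = eq _ _

  Window-cong : {f g : Adjacency (6 + k)} → f ≐ g → Window f → Window g
  Window-cong eq (inj₁ (good i c)) = inj₁ (good
    (≤-trans (≤-reflexive (sym (indep-cong (left-cong {m = 6} eq)))) i)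
    (≤-trans (≤-reflexive (sym (indep-cong (co-cong (left-cong {m = 6} eq))))) c))
  Window-cong eq (inj₂ s) = inj₂ (Sparse-cong eq s)

  HasWindow : Adjacency (6 + k) → Set
  HasWindow f = ∃[ π ] (Window (pull π f) ⊎ Window (co (pull π f)))

  dense-window : {f : Adjacency (6 + k)} → Simple f → Dense f → HasWindow f
  dense-window {k} {f} sf dense = by-selection (select (co-Simple sf))
    where
    same : ∀ π → co (left 6 (pull (eval (decompose π)) f)) ≐ left 6 (pull π (co f))
    same π u v = trans
      (cong₂ (λ x y → distinct u v ∧ not (f x y)) (eval-decompose π (u ↑ˡ k)) (eval-decompose π (v ↑ˡ k)))
      (trans (sym (left-co (pull π f) u v)) (sym (pull-co π f (u ↑ˡ k) (v ↑ˡ k))))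
    by-selection : Selected (co f) → HasWindow f
    by-selection (π , inj₂ sparse) = π , inj₂ (inj₂ (Sparse-cong (pull-co π f) sparse))
    -- The swaps lead from the present window to one where the complement has at most 27 independent
    -- sets. Remaining dense to the end would give it at least 28, so a good window was met on the
    -- way.
    by-selection (π , inj₁ few) =
      [ (λ (ρ , g) → ρ , inj₁ (inj₁ g)) ,
        (λ still-dense → ⊥-elim (<⇒≱ still-dense (≤-trans (≤-reflexive (indep-cong (same π))) few))) ]′
      (dense-transpositions sf dense (decompose π))

  has-window : {f : Adjacency (6 + k)} → Simple f → HasWindow f
  has-window {f = f} sf = decide (indep (left 6 f) ≤? 27) (indep (co (left 6 f)) ≤? 27)
    where
    complementary : HasWindow (co f) → HasWindow f
    complementary (π , inj₁ w) = π , inj₂ (Window-cong (pull-co π f) w)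
    complementary (π , inj₂ w) = π , inj₁ (Window-cong
      (λ u v → trans (co-cong (pull-co π f) u v) (co-co (pull-Simple π sf) u v)) w)
    decide : Dec (indep (left 6 f) ≤ 27) → Dec (indep (co (left 6 f)) ≤ 27) → HasWindow f
    decide (yes i) (yes c) = Perm.id , inj₁ (inj₁ (good i c))
    decide _ (no c) = dense-window sf (≰⇒> c)
    decide (no i) _ = complementary (dense-window (co-Simple sf) (subst (28 ≤_)
      (indep-cong (λ u v → sym (trans (co-cong (left-co f) u v) (co-co (left-Simple 6 sf) u v)))) (≰⇒> i)))

open import Defs
open Counting
open BranchAndBound
open WindowChecks
open WindowBounds
open UpperBound
open Equality
open WindowExistence
open import Data.Bool.Base using (true; false; not; _∧_)
open import Data.Bool.Properties using (∧-identityʳ)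
open import Data.Fin.Base using (Fin; zero; suc; _↑ˡ_; _↑ʳ_; splitAt)
open import Data.Fin.Permutation as Perm using (Permutation; Permutation′; permutation; _⟨$⟩ʳ_; _⟨$⟩ˡ_; _∘ₚ_)
open import Data.Fin.Properties using (_≟_; splitAt-↑ˡ; splitAt-↑ʳ; ↑ˡ-injective; ↑ʳ-injective)
open import Data.Fin.Subset using (∣_∣)
open import Data.Integer.Base as ℤ using (ℤ; +_)
import Data.Integer.Properties as ℤ
open import Data.List.Properties using (map-cong)
open import Data.Nat.Base as ℕ using (ℕ; zero; suc; _^_; _∸_; s≤s; z≤n)
open import Data.Nat.Coprimality using (1-coprimeTo) renaming (sym to coprime-sym)
open import Data.Nat.ListAction using (sum)
import Data.Nat.Properties as ℕ
open import Data.Nat.Tactic.RingSolver using (solve-∀)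
open import Data.Product.Base using (_×_; _,_; proj₁; proj₂)
open import Data.Rational.Base using (ℚ; mkℚ; _/_; _+_; _*_; _-_; -_; _≤_; *≤*)
import Data.Rational.Properties as ℚₚ
open import Data.Sum.Base using (_⊎_; inj₁; inj₂; [_,_]′)
import Data.Vec.Base as Vec
open import Function.Base using (_∘_; id)
open import Function.Bundles using (_⇔_; mk⇔)
open import Relation.Binary.PropositionalEquality
open import Relation.Nullary.Decidable using (dec-false)

private variable
  k m n : ℕ

-- The bound as a rational number

-- The division in `fromℕ` normalises by a gcd and is stuck on a variable. The explicit reduced form
-- exposes numerator and denominator, from which order, injectivity and arithmetic follow.
fromℕ-mkℚ : ∀ a → fromℕ a ≡ mkℚ (+ a) 0 (coprime-sym (1-coprimeTo a))
fromℕ-mkℚ a = ℚₚ.normalize-coprime (coprime-sym (1-coprimeTo a))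

fromℕ-mono : ∀ {a b} → a ℕ.≤ b → fromℕ a ≤ fromℕ b
fromℕ-mono {a} {b} le = subst₂ _≤_ (sym (fromℕ-mkℚ a)) (sym (fromℕ-mkℚ b))
  (*≤* (ℤ.*-monoʳ-≤-nonNeg (+ 1) (ℤ.+≤+ le)))

fromℕ-injective : ∀ {a b} → fromℕ a ≡ fromℕ b → a ≡ b
fromℕ-injective {a} {b} eq = ℤ.+-injective (cong ℚ.numerator (trans (sym (fromℕ-mkℚ a)) (trans eq (fromℕ-mkℚ b))))

fromℕ-+ : ∀ a b → fromℕ (a ℕ.+ b) ≡ fromℕ a + fromℕ b
fromℕ-+ a b = sym (trans (cong₂ _+_ (fromℕ-mkℚ a) (fromℕ-mkℚ b))
  (cong (_/ 1) (cong₂ ℤ._+_ (ℤ.*-identityʳ (+ a)) (ℤ.*-identityʳ (+ b)))))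

fromℕ-* : ∀ a b → fromℕ (a ℕ.* b) ≡ fromℕ a * fromℕ b
fromℕ-* a b = sym (trans (cong₂ _*_ (fromℕ-mkℚ a) (fromℕ-mkℚ b)) (cong (_/ 1) (sym (ℤ.pos-* a b))))

tri-double : ∀ k → tri k ℕ.+ tri k ℕ.+ k ≡ k ℕ.* k
tri-double zero = refl
tri-double (suc k) = trans (regroup k (tri k)) (trans (cong (λ x → suc (k ℕ.+ k ℕ.+ x)) (tri-double k)) (square k))
  where
  regroup : ∀ k t → (k ℕ.+ t) ℕ.+ (k ℕ.+ t) ℕ.+ suc k ≡ suc (k ℕ.+ k ℕ.+ (t ℕ.+ t ℕ.+ k))
  regroup = solve-∀
  square : ∀ k → suc (k ℕ.+ k ℕ.+ k ℕ.* k) ≡ suc k ℕ.* suc k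
  square = solve-∀

bound : ℕ → ℚ
bound n = (+ 27 / 64) * fromℕ (2 ^ n) + (+ 1 / 2) * (fromℕ (n ℕ.+ 2) * (fromℕ n - fromℕ 3))

-- For n = 6 + k, the power contributes 27 · 2^k, and (n+2)(n-3)/2 = (k+8)(k+3)/2 equals 12 + 6k +
-- k(k-1)/2. Both fractions are cleared over the natural numbers, where `tri-double` replaces
-- k(k-1)/2 without subtraction.
bound-maximum : ∀ k → bound (6 ℕ.+ k) ≡ fromℕ (maximum k)
bound-maximum k = trans (cong₂ _+_ exponential quadratic) (sym (fromℕ-+ (27 ℕ.* 2 ^ k) rest))
  where
  open ≡-Reasoning
  rest = 12 ℕ.+ (6 ℕ.* k ℕ.+ tri k)
  power : ∀ x → 2 ℕ.* (2 ℕ.* (2 ℕ.* (2 ℕ.* (2 ℕ.* (2 ℕ.* x))))) ≡ 64 ℕ.* x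
  power = solve-∀
  cancel : ∀ p a b x → p * fromℕ a ≡ fromℕ b → p * fromℕ (a ℕ.* x) ≡ fromℕ (b ℕ.* x)
  cancel p a b x eq = begin
    p * fromℕ (a ℕ.* x)      ≡⟨ cong (p *_) (fromℕ-* a x) ⟩
    p * (fromℕ a * fromℕ x)  ≡⟨ ℚₚ.*-assoc p (fromℕ a) (fromℕ x) ⟨
    p * fromℕ a * fromℕ x    ≡⟨ cong (_* fromℕ x) eq ⟩
    fromℕ b * fromℕ x        ≡⟨ fromℕ-* b x ⟨
    fromℕ (b ℕ.* x)          ∎
  exponential : (+ 27 / 64) * fromℕ (2 ^ (6 ℕ.+ k)) ≡ fromℕ (27 ℕ.* 2 ^ k)
  exponential = trans (cong (λ x → (+ 27 / 64) * fromℕ x) (power (2 ^ k))) (cancel (+ 27 / 64) 64 27 (2 ^ k) refl)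
  difference : fromℕ (6 ℕ.+ k) - fromℕ 3 ≡ fromℕ (3 ℕ.+ k)
  difference = begin
    fromℕ (3 ℕ.+ (3 ℕ.+ k)) - fromℕ 3          ≡⟨ cong (_- fromℕ 3) (fromℕ-+ 3 (3 ℕ.+ k)) ⟩
    fromℕ 3 + fromℕ (3 ℕ.+ k) - fromℕ 3        ≡⟨ cong (_- fromℕ 3) (ℚₚ.+-comm (fromℕ 3) (fromℕ (3 ℕ.+ k))) ⟩
    fromℕ (3 ℕ.+ k) + fromℕ 3 - fromℕ 3        ≡⟨ ℚₚ.+-assoc (fromℕ (3 ℕ.+ k)) (fromℕ 3) (- fromℕ 3) ⟩
    fromℕ (3 ℕ.+ k) + (fromℕ 3 - fromℕ 3)      ≡⟨ cong (λ x → fromℕ (3 ℕ.+ k) + x) (ℚₚ.+-inverseʳ (fromℕ 3)) ⟩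
    fromℕ (3 ℕ.+ k) + fromℕ 0                  ≡⟨ ℚₚ.+-identityʳ (fromℕ (3 ℕ.+ k)) ⟩
    fromℕ (3 ℕ.+ k)                            ∎
  expand : ∀ k t → 24 ℕ.+ 12 ℕ.* k ℕ.+ (t ℕ.+ t) ≡ 2 ℕ.* (12 ℕ.+ (6 ℕ.* k ℕ.+ t))
  expand = solve-∀
  product : ∀ k → (6 ℕ.+ k ℕ.+ 2) ℕ.* (3 ℕ.+ k) ≡ 24 ℕ.+ 11 ℕ.* k ℕ.+ k ℕ.* k
  product = solve-∀
  collect : ∀ k t → 24 ℕ.+ 11 ℕ.* k ℕ.+ (t ℕ.+ t ℕ.+ k) ≡ 24 ℕ.+ 12 ℕ.* k ℕ.+ (t ℕ.+ t)
  collect = solve-∀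
  even : (6 ℕ.+ k ℕ.+ 2) ℕ.* (3 ℕ.+ k) ≡ 2 ℕ.* rest
  even = trans (product k) (trans (cong (24 ℕ.+ 11 ℕ.* k ℕ.+_) (sym (tri-double k)))
    (trans (collect k (tri k)) (expand k (tri k))))
  quadratic : (+ 1 / 2) * (fromℕ (6 ℕ.+ k ℕ.+ 2) * (fromℕ (6 ℕ.+ k) - fromℕ 3)) ≡ fromℕ rest
  quadratic = begin
    (+ 1 / 2) * (fromℕ (6 ℕ.+ k ℕ.+ 2) * (fromℕ (6 ℕ.+ k) - fromℕ 3))
      ≡⟨ cong (λ x → (+ 1 / 2) * (fromℕ (6 ℕ.+ k ℕ.+ 2) * x)) difference ⟩
    (+ 1 / 2) * (fromℕ (6 ℕ.+ k ℕ.+ 2) * fromℕ (3 ℕ.+ k))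
      ≡⟨ cong ((+ 1 / 2) *_) (fromℕ-* (6 ℕ.+ k ℕ.+ 2) (3 ℕ.+ k)) ⟨
    (+ 1 / 2) * fromℕ ((6 ℕ.+ k ℕ.+ 2) ℕ.* (3 ℕ.+ k))
      ≡⟨ cong (λ x → (+ 1 / 2) * fromℕ x) even ⟩
    (+ 1 / 2) * fromℕ (2 ℕ.* rest)
      ≡⟨ cancel (+ 1 / 2) 2 1 rest refl ⟩
    fromℕ (1 ℕ.* rest)
      ≡⟨ cong fromℕ (ℕ.*-identityˡ rest) ⟩
    fromℕ rest ∎

-- Isomorphism, complementation and the extremal graphs

infix 4 _≈_
record _≈_ (f g : Adjacency n) : Set where
  constructor via
  field
    perm : Permutation′ n
    same : f ≐ pull perm g

co-≈ : {f g : Adjacency n} → f ≈ g → co f ≈ co g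
co-≈ {g = g} (via π eq) = via π λ u v → trans (co-cong eq u v) (sym (pull-co π g u v))

≈-trans : {f g h : Adjacency n} → f ≈ g → g ≈ h → f ≈ h
≈-trans (via π eq) (via ρ eq′) = via (π ∘ₚ ρ) λ u v → trans (eq u v) (eq′ _ _)

≈-sym-pull : (π : Permutation′ n) {f : Adjacency n} → f ≈ pull π f
≈-sym-pull π {f} = via (Perm.flip π) λ u v → sym (cong₂ f (Perm.inverseʳ π) (Perm.inverseʳ π))

σσ-≈ : {f g : Adjacency n} → Simple f → Simple g → f ≈ g → σσ f ≡ σσ g
σσ-≈ {g = g} sf sg (via π eq) = cong₂ ℕ._+_ (∑ₛ-edges-relabel only π sf sg eq)
  (∑ₛ-edges-relabel only π (co-Simple sf) (co-Simple sg) (λ u v → trans (co-cong eq u v) (sym (pull-co π g u v))))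

σσ-co : {f : Adjacency n} → Simple f → σσ (co f) ≡ σσ f
σσ-co {f = f} sf = trans (cong (σ (co f) ℕ.+_) (∑ₛ-cong (λ S → cong only (edges-cong (co-co sf) S)))) (ℕ.+-comm (σ (co f)) (σ f))

adj-Simple : (G : Graph n) → Simple (adj G)
adj-Simple G = simple (adj-sym G) (adj-irrefl G)

extremalGraph : ∀ k → Graph (6 ℕ.+ k)
extremalGraph k = 3K₂ ∪ edgeless k

extend : Permutation′ 6 → Permutation′ (6 ℕ.+ k)
extend {k} τ = permutation (to (τ ⟨$⟩ʳ_)) (to (τ ⟨$⟩ˡ_)) (inverse (λ _ → Perm.inverseʳ τ)) (inverse (λ _ → Perm.inverseˡ τ))
  where
  to : (Fin 6 → Fin 6) → Fin (6 ℕ.+ k) → Fin (6 ℕ.+ k)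
  to t i = [ (λ a → t a ↑ˡ k) , (6 ↑ʳ_) ]′ (splitAt 6 i)
  inverse : ∀ {t s : Fin 6 → Fin 6} → (∀ a → t (s a) ≡ a) → ∀ i → to t (to s i) ≡ i
  inverse {t} {s} inv i with side 6 i
  ... | inside a rewrite splitAt-↑ˡ 6 a k | splitAt-↑ˡ 6 (s a) k = cong (_↑ˡ k) (inv a)
  ... | outside b rewrite splitAt-↑ʳ 6 k b | splitAt-↑ʳ 6 k b = refl

Extremal-≈ : {f : Adjacency (6 ℕ.+ k)} → Simple f → Extremal f → f ≈ adj (extremalGraph k)
Extremal-≈ {k} {f} sf (extremal {τ} window outer) = via (extend τ) same
  where
  same : ∀ u v → f u v ≡ adj (extremalGraph k) (extend τ ⟨$⟩ʳ u) (extend τ ⟨$⟩ʳ v)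
  same u v with side 6 u | side 6 v
  ... | inside a | inside b rewrite splitAt-↑ˡ 6 a k | splitAt-↑ˡ 6 b k
          | splitAt-↑ˡ 6 (τ ⟨$⟩ʳ a) k | splitAt-↑ˡ 6 (τ ⟨$⟩ʳ b) k = window a b
  ... | inside a | outside b rewrite splitAt-↑ˡ 6 a k | splitAt-↑ʳ 6 k b
          | splitAt-↑ˡ 6 (τ ⟨$⟩ʳ a) k | splitAt-↑ʳ 6 k b = trans (symmetric sf _ _) (outer b _)
  ... | outside a | inside b rewrite splitAt-↑ʳ 6 k a | splitAt-↑ˡ 6 b k
          | splitAt-↑ʳ 6 k a | splitAt-↑ˡ 6 (τ ⟨$⟩ʳ b) k = outer a _
  ... | outside a | outside b rewrite splitAt-↑ʳ 6 k a | splitAt-↑ʳ 6 k b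
          | splitAt-↑ʳ 6 k a | splitAt-↑ʳ 6 k b = outer a _

-- In `extremalGraph` the six special vertices come first, in `K k ∨ G₆,₄` they come last. This
-- shift is the isomorphism between the complement of the former and the latter.
rotate : ∀ m k → Permutation (m ℕ.+ k) (k ℕ.+ m)
rotate m k = permutation (turn m k) (turn k m) (turn-turn k m) (turn-turn m k)
  where
  turn : ∀ m k → Fin (m ℕ.+ k) → Fin (k ℕ.+ m)
  turn m k i = [ (k ↑ʳ_) , (_↑ˡ m) ]′ (splitAt m i)
  turn-turn : ∀ m k i → turn k m (turn m k i) ≡ i
  turn-turn m k i with side m i
  ... | inside a rewrite splitAt-↑ˡ m a k | splitAt-↑ʳ k m a = refl
  ... | outside b rewrite splitAt-↑ʳ m k b | splitAt-↑ˡ k b m = refl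

distinct-true : {u v : Fin n} → u ≢ v → distinct u v ≡ true
distinct-true {u = u} {v} u≢v = cong not (dec-false (u ≟ v) u≢v)

complement-extremal : ∀ k u v → co (adj (extremalGraph k)) u v ≡
  adj (K k ∨ G₆,₄) (rotate 6 k ⟨$⟩ʳ u) (rotate 6 k ⟨$⟩ʳ v)
complement-extremal k u v with side 6 u | side 6 v
... | inside a | inside b rewrite splitAt-↑ˡ 6 a k | splitAt-↑ˡ 6 b k | splitAt-↑ʳ k 6 a | splitAt-↑ʳ k 6 b =
  cong (_∧ not (adj 3K₂ a b)) (distinct-injective (_↑ˡ k) (↑ˡ-injective k _ _) a b)
... | inside a | outside b rewrite splitAt-↑ˡ 6 a k | splitAt-↑ʳ 6 k b | splitAt-↑ʳ k 6 a | splitAt-↑ˡ k b 6 =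
  cong (_∧ true) (distinct-true (↑ˡ≢↑ʳ a b))
... | outside a | inside b rewrite splitAt-↑ʳ 6 k a | splitAt-↑ˡ 6 b k | splitAt-↑ˡ k a 6 | splitAt-↑ʳ k 6 b =
  cong (_∧ true) (distinct-true (↑ˡ≢↑ʳ b a ∘ sym))
... | outside a | outside b rewrite splitAt-↑ʳ 6 k a | splitAt-↑ʳ 6 k b | splitAt-↑ˡ k a 6 | splitAt-↑ˡ k b 6 =
  trans (∧-identityʳ _) (distinct-injective (6 ↑ʳ_) (↑ʳ-injective 6 _ _) a b)

-- Attainment of the bound and the final equivalence

countOf-cap : ∀ s → countOf (adj 3K₂) 0 (tri s) s ≡ cap s
countOf-cap 0 = refl
countOf-cap 1 = refl
countOf-cap 2 = refl
-- From three outside vertices on, B alone has at least two non-edges. Each term then only asks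
-- whether A induces one edge of 3K₂, independently of `s`, and evaluation gives 27.
countOf-cap (suc (suc (suc s))) = cong sum (map-cong
  (λ A → one-only (edges (adj 3K₂) A) (ℕ.≤-trans (ℕ.≤-trans (ℕ.n≤1+n 2) (tri-≥3 s)) (ℕ.m≤m+n (tri (3 ℕ.+ s)) (dot A (Vec.replicate 6 (3 ℕ.+ s)) ℕ.+ edges (co (adj 3K₂)) A)))) (allSubsets 6))

σσ-extremal : ∀ k → σσ (adj (extremalGraph k)) ≡ maximum k
σσ-extremal k = trans (σσ-count f) (trans (∑ₛ-cong per) (∑-cap k))
  where
  f = adj (extremalGraph k)
  separate : Apart f
  separate = apart λ i j → cong₂ (Combine.adj⊎ false 3K₂ (edgeless k)) (splitAt-↑ˡ 6 i k) (splitAt-↑ʳ 6 k j)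
  window : left 6 f ≐ adj 3K₂
  window u v = cong₂ (Combine.adj⊎ false 3K₂ (edgeless k)) (splitAt-↑ˡ 6 u k) (splitAt-↑ˡ 6 v k)
  none-right : ∀ B → edges (right 6 f) B ≡ 0
  none-right = zero-edges _ (λ u v → cong₂ (Combine.adj⊎ false 3K₂ (edgeless k)) (splitAt-↑ʳ 6 k u) (splitAt-↑ʳ 6 k v))
  all-right : ∀ B → edges (right 6 (co f)) B ≡ tri ∣ B ∣
  all-right B = trans (cong (ℕ._+ edges (right 6 (co f)) B) (sym (none-right B))) (right-co-edges f B)
  per : ∀ B → count f B ≡ cap ∣ B ∣
  per B = trans (count-apart f separate window B)
    (trans (cong₂ (λ e e′ → countOf (adj 3K₂) e e′ ∣ B ∣) (none-right B) (all-right B)) (countOf-cap ∣ B ∣))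

σσ-bound : {f : Adjacency (6 ℕ.+ k)} → Simple f →
  σσ f ℕ.≤ maximum k × (σσ f ≡ maximum k → f ≈ adj (extremalGraph k) ⊎ f ≈ co (adj (extremalGraph k)))
σσ-bound {k} {f} sf with has-window sf
... | π , w = result w
  where
  g = pull π f
  sg = pull-Simple π sf
  f≈g : f ≈ g
  f≈g = ≈-sym-pull π
  same : σσ f ≡ σσ g
  same = σσ-≈ sf sg f≈g
  same-co : σσ f ≡ σσ (co g)
  same-co = trans same (sym (σσ-co sg))
  from : ∀ {h} → Simple h → f ≈ h → Extremal h ⊎ Extremal (co h) → f ≈ adj (extremalGraph k) ⊎ f ≈ co (adj (extremalGraph k))
  from {h} sh f≈h (inj₁ e) = inj₁ (≈-trans f≈h (Extremal-≈ sh e))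
  -- `h` is its own double complement, so an isomorphism for `co h` is complemented once more.
  from {h} sh f≈h (inj₂ e) = inj₂ (≈-trans f≈h (≈-trans (via Perm.id λ u v → sym (co-co sh u v)) (co-≈ (Extremal-≈ (co-Simple sh) e))))
  swap : Extremal (co g) ⊎ Extremal (co (co g)) → Extremal g ⊎ Extremal (co g)
  swap (inj₁ e) = inj₂ e
  swap (inj₂ (extremal {τ} window outer)) = inj₁ (extremal {perm = τ}
    (λ u v → trans (sym (co-co sg (u ↑ˡ k) (v ↑ˡ k))) (window u v)) (λ j u → trans (sym (co-co sg (6 ↑ʳ j) u)) (outer j u)))
  result : Window g ⊎ Window (co g) → σσ f ℕ.≤ maximum k × (σσ f ≡ maximum k → f ≈ adj (extremalGraph k) ⊎ f ≈ co (adj (extremalGraph k)))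
  result (inj₁ w) = subst (ℕ._≤ maximum k) (sym same) (σσ≤maximum sg w) ,
    λ eq → from sg f≈g (tight-cases sg (σσ-tight sg w (trans (sym same) eq)))
  result (inj₂ w) = subst (ℕ._≤ maximum k) (sym same-co) (σσ≤maximum (co-Simple sg) w) ,
    λ eq → from sg f≈g (swap (tight-cases (co-Simple sg) (σσ-tight (co-Simple sg) w (trans (sym same-co) eq))))

≈⇒≅ : {G : Graph (6 ℕ.+ k)} → adj G ≈ adj (extremalGraph k) ⊎ adj G ≈ co (adj (extremalGraph k)) →
  G ≅ extremalGraph k ⊎ G ≅ K k ∨ G₆,₄
≈⇒≅ (inj₁ (via π eq)) = inj₁ (record { bij = π ; preserve = eq })
≈⇒≅ {k} (inj₂ (via π eq)) = inj₂ (record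
  { bij = π ∘ₚ rotate 6 k
  ; preserve = λ u v → trans (eq u v) (complement-extremal k (π ⟨$⟩ʳ u) (π ⟨$⟩ʳ v)) })

≅⇒≈ : {G : Graph (6 ℕ.+ k)} → G ≅ extremalGraph k ⊎ G ≅ K k ∨ G₆,₄ →
  adj G ≈ adj (extremalGraph k) ⊎ adj G ≈ co (adj (extremalGraph k))
≅⇒≈ (inj₁ iso) = inj₁ (via (_≅_.bij iso) (_≅_.preserve iso))
≅⇒≈ {k} (inj₂ iso) = inj₂ (via (_≅_.bij iso ∘ₚ Perm.flip (rotate 6 k)) λ u v → trans (_≅_.preserve iso u v)
  (sym (trans (complement-extremal k (Perm.flip (rotate 6 k) ⟨$⟩ʳ (_≅_.bij iso ⟨$⟩ʳ u)) (Perm.flip (rotate 6 k) ⟨$⟩ʳ (_≅_.bij iso ⟨$⟩ʳ v)))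
    (cong₂ (adj (K k ∨ G₆,₄)) (Perm.inverseʳ (rotate 6 k)) (Perm.inverseʳ (rotate 6 k))))))

σσ-≅ : {G : Graph (6 ℕ.+ k)} → adj G ≈ adj (extremalGraph k) ⊎ adj G ≈ co (adj (extremalGraph k)) → σσ (adj G) ≡ maximum k
σσ-≅ {k} {G} (inj₁ iso) = trans (σσ-≈ (adj-Simple G) (adj-Simple (extremalGraph k)) iso) (σσ-extremal k)
σσ-≅ {k} {G} (inj₂ iso) = trans (σσ-≈ (adj-Simple G) (co-Simple (adj-Simple (extremalGraph k))) iso)
  (trans (σσ-co (adj-Simple (extremalGraph k))) (σσ-extremal k))

bound-and-equality : ∀ k (G : Graph (6 ℕ.+ k)) → let total = fromℕ (σ₁ G ℕ.+ σ₁ (complement G)) in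
  total ≤ bound (6 ℕ.+ k) × (total ≡ bound (6 ℕ.+ k) ⇔ (G ≅ extremalGraph k ⊎ G ≅ K k ∨ G₆,₄))
bound-and-equality k G = ≤bound , mk⇔ forward backward
  where
  total-σσ : σ₁ G ℕ.+ σ₁ (complement G) ≡ σσ (adj G)
  total-σσ = cong₂ ℕ._+_ (σ₁-σ G) (σ₁-σ (complement G))
  sf = adj-Simple G
  sum₁ = fromℕ (σ₁ G ℕ.+ σ₁ (complement G))
  ≤bound : sum₁ ≤ bound (6 ℕ.+ k)
  ≤bound = subst₂ _≤_ (cong fromℕ (sym total-σσ)) (sym (bound-maximum k)) (fromℕ-mono (proj₁ (σσ-bound sf)))
  forward : sum₁ ≡ bound (6 ℕ.+ k) → G ≅ extremalGraph k ⊎ G ≅ K k ∨ G₆,₄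
  forward eq = ≈⇒≅ (proj₂ (σσ-bound sf) (fromℕ-injective (trans (cong fromℕ (sym total-σσ)) (trans eq (bound-maximum k)))))
  backward : G ≅ extremalGraph k ⊎ G ≅ K k ∨ G₆,₄ → sum₁ ≡ bound (6 ℕ.+ k)
  backward iso = trans (cong fromℕ (trans total-σσ (σσ-≅ {G = G} (≅⇒≈ iso)))) (sym (bound-maximum k))

theorem4 : (n : ℕ) → 6 ℕ.≤ n → (G : Graph n) →
    let total = fromℕ (σ₁ G ℕ.+ σ₁ (complement G))
        bound = (+ 27 / 64) * fromℕ (2 ^ n) + (+ 1 / 2) * (fromℕ (n ℕ.+ 2) * (fromℕ n - fromℕ 3))
    in total ≤ bound × (total ≡ bound ⇔ (G ≅ 3K₂ ∪ edgeless (n ∸ 6) ⊎ G ≅ K (n ∸ 6) ∨ G₆,₄))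
-- Matching on the inequality turns n into 6 + k definitionally, so that `n ∸ 6` computes to `k`.
theorem4 _ (s≤s (s≤s (s≤s (s≤s (s≤s (s≤s (z≤n {k}))))))) G = bound-and-equality k G
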